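{- Let $P=\{1423\}$. For $n\ge2$ and integer $l$, let $c_{n,l}$ be the number of $l$-clusters relative to $P$ whose permutation has length $n$ (with $c_{n,l}=0$ for $l\le0$), and set $c_{1,l}=\delta_{0,l}$. Then $c_{2,l}=c_{3,l}=0$ for all $l$, and for all $n\ge4$ and all $l$, $$c_{n,l}=\sum_{k\ge1,\ 2k+2\le n}\binom{n-k-2}{k}\,c_{n-2k-1,\,l-k}.$$ Consequently, if $\pi_{n,k}$ is the number of permutations of length $n$ with exactly $k$ occurrences of $1423$ and $\Pi(x,t)=\sum_{n,k}\pi_{n,k}\frac{x^n}{n!}t^k$, then $$\Pi(x,t)=\Big(1-x-\sum_{n\ge2,\,l\ge1}\frac{c_{n,l}\,x^n(t-1)^l}{n!}\Big)^{ -1}.$$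
   Context: A permutation of length $n$ is a sequence containing each of $1,\dots,n$ exactly once. For a sequence $s$ of distinct integers, $\mathrm{st}(s)$ is the unique permutation with the same relative order of entries. An occurrence of a pattern $\pi$ in $\sigma$ is a consecutive segment $\sigma_i\cdots\sigma_j$ with $\mathrm{st}(\sigma_i\cdots\sigma_j)=\pi$. For a set $P$ of patterns, a $q$-cluster ($q\ge1$) is a tuple $(\sigma,\pi_1,\dots,\pi_q,i_1,\dots,i_q)$ with $\sigma$ a permutation of length $n$, $\pi_k\in P$ of length $r_k$, such that $\mathrm{st}(\sigma_{i_k}\cdots\sigma_{i_k+r_k-1})=\pi_k$ for all $k$, $i_k<i_{k+1}<i_k+r_k$ for $k<q$, $i_1=1$ and $n=i_q+r_q-1$. $\delta$ is the Kronecker delta. -}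

module Defs where

open import Level using (Level)
open import Data.Bool using (Bool; true; false; _∧_; if_then_else_)
open import Data.Nat using (ℕ; zero; suc; _+_; _*_; _∸_; _≡ᵇ_; _<ᵇ_; _≤ᵇ_)
open import Data.Nat.Combinatorics using (_C_)
open import Data.Integer as ℤ using (ℤ; +_; -[1+_])
open import Data.List using (List; []; _∷_; map; filter; length; take; drop; concatMap; upTo; foldr)
open import Data.Bool.ListAction using (any; all)
open import Data.Nat.ListAction using (sum)
open import Data.Nat.Properties using (_<?_)
open import Data.Product using (_×_; _,_)
open import Algebra.Bundles using (CommutativeRing)

range : ℕ → List ℕ
range n = map suc (upTo n)

_==_ : List ℕ → List ℕ → Bool
[] == [] = true
(x ∷ xs) == (y ∷ ys) = (x ≡ᵇ y) ∧ (xs == ys)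
_ == _ = false

-- standardization: each entry x replaced by 1 + #(entries smaller than x);
-- for a sequence of distinct integers this is st(s) from the paper
st : List ℕ → List ℕ
st s = map (λ x → suc (length (filter (_<? x) s))) s

words : ℕ → ℕ → List (List ℕ)
words n zero = [] ∷ []
words n (suc k) = concatMap (λ w → map (_∷ w) (range n)) (words n k)

isPerm : ℕ → List ℕ → Bool
isPerm n σ = (length σ ≡ᵇ n) ∧ all (λ j → any (λ x → x ≡ᵇ j) σ) (range n)

perms : ℕ → List (List ℕ)
perms n = filter (λ σ → Data.Bool._≟_ (isPerm n σ) true) (words n n)

segment : List ℕ → ℕ → ℕ → List ℕ
segment σ i r = take r (drop (i ∸ 1) σ)

occursAt : ℕ → List ℕ → List ℕ → ℕ → Bool
occursAt n σ π i = (1 ≤ᵇ i) ∧ ((i + length π ∸ 1) ≤ᵇ n) ∧ (st (segment σ i (length π)) == π)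

chainOK : ℕ → List (List ℕ × ℕ) → Bool
chainOK n [] = false
chainOK n ((π , i) ∷ []) = n ≡ᵇ (i + length π ∸ 1)
chainOK n ((π , i) ∷ rest@((π' , i') ∷ _)) =
  (i <ᵇ i') ∧ (i' <ᵇ (i + length π)) ∧ chainOK n rest
  where open import Data.Product using (_,_)

-- (σ, π_1..π_q, i_1..i_q) is a q-cluster; the tuple is encoded as the list
-- of pairs (π_k , i_k)
isCluster : List (List ℕ) → ℕ → List ℕ → List (List ℕ × ℕ) → Bool
isCluster P n σ [] = false
isCluster P n σ tup@((π₁ , i₁) ∷ _) =
  (i₁ ≡ᵇ 1)
  ∧ all (λ { (π , i) → any (λ ρ → ρ == π) P ∧ occursAt n σ π i }) tup
  ∧ chainOK n tup
  where open import Data.Product using (_,_)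

tuples : List (List ℕ) → ℕ → ℕ → List (List (List ℕ × ℕ))
tuples P n zero = [] ∷ []
tuples P n (suc q) =
  concatMap (λ t → concatMap (λ π → map (λ i → (π , i) ∷ t) (range n)) P) (tuples P n q)
  where open import Data.Product using (_,_)

numClusters : List (List ℕ) → ℕ → ℕ → ℕ
numClusters P n q =
  sum (map (λ σ → length (filter (λ t → Data.Bool._≟_ (isCluster P n σ t) true) (tuples P n q)))
           (perms n))

p1423 : List ℕ
p1423 = 1 ∷ 4 ∷ 2 ∷ 3 ∷ []

P1423 : List (List ℕ)
P1423 = p1423 ∷ []

-- c_{n,l} for integer l:  c_{1,l} = δ_{0,l};  for n ≥ 2, c_{n,l} = 0 when l ≤ 0,
-- otherwise the number of l-clusters of length n.  (c_{0,l} is never used; set to 0.)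
c : ℕ → ℤ → ℕ
c zero l = 0
c (suc zero) (+ zero) = 1
c (suc zero) (+ suc _) = 0
c (suc zero) -[1+ _ ] = 0
c (suc (suc m)) (+ l) = numClusters P1423 (suc (suc m)) l
c (suc (suc m)) -[1+ _ ] = 0

occurrences : ℕ → List ℕ → List ℕ → ℕ
occurrences n σ π = length (filter (λ i → Data.Bool._≟_ (occursAt n σ π i) true) (range n))

piNK : ℕ → ℕ → ℕ
piNK n k = length (filter (λ σ → Data.Nat._≟_ (occurrences n σ p1423) k) (perms n))

recRHS : ℕ → ℤ → ℕ
recRHS n l =
  sum (map (λ k → ((n ∸ k ∸ 2) C k) * c (n ∸ 2 * k ∸ 1) (l ℤ.- (+ k)))
           (filter (λ k → Data.Nat._≤?_ (2 * k + 2) n) (range n)))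

-- Generating-function part, evaluated in an arbitrary commutative ring R
-- at an arbitrary element t (the EGF identity Π · D = 1 written
-- coefficientwise in x, multiplied by n!).

module EGF {a ℓ : Level} (R : CommutativeRing a ℓ) (t : CommutativeRing.Carrier R) where
  open CommutativeRing R using (Carrier; 0#; 1#; -_) renaming (_+_ to _⊕_; _*_ to _⊗_; _-_ to _⊖_)

  ι : ℕ → Carrier
  ι zero = 0#
  ι (suc n) = 1# ⊕ ι n

  pow : Carrier → ℕ → Carrier
  pow x zero = 1#
  pow x (suc n) = x ⊗ pow x n

  Σ : List Carrier → Carrier
  Σ = foldr _⊕_ 0#

  -- n! [x^n] Π(x,t) = Σ_k π_{n,k} t^k   (k ≤ n since occurrences ≤ n)
  Pi : ℕ → Carrier
  Pi n = Σ (map (λ k → ι (piNK n k) ⊗ pow t k) (upTo (suc n)))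

  -- n! [x^n] D(x,t), where D = 1 - x - Σ_{n≥2,l≥1} c_{n,l} x^n (t-1)^l / n!
  -- (c_{n,l} = 0 for l > n, so the l-sum is truncated at n)
  D : ℕ → Carrier
  D zero = 1#
  D (suc zero) = - 1#
  D n@(suc (suc _)) = - Σ (map (λ l → ι (c n (+ l)) ⊗ pow (t ⊖ 1#) l) (range n))

  -- n! [x^n] (Π · D)
  prodCoeff : ℕ → Carrier
  prodCoeff n = Σ (map (λ m → ι (n C m) ⊗ (Pi m ⊗ D (n ∸ m))) (upTo (suc n)))

  one : ℕ → Carrier
  one zero = 1#
  one (suc _) = 0#

{-# OPTIONS --safe #-}
module Submission where

-- Sums over all permutations are built by inserting one entry at a time. Insertion obeys a Leibniz
-- rule with respect to cutting a word in two, so a sum over words of (F of a prefix) times (G of the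
-- remaining suffix) becomes a binomial convolution when F and G depend only on relative order.
--
-- Generating function: t ^ (number of occurrences) expands as a sum over sets of marked occurrences,
-- and the maximal chain of overlapping marks at the front of a word cuts off a cluster. For 1423 this
-- is a telescoping identity on each single word.
--
-- Recurrence: occurrences of 1423 overlap only with shift 2 or 3. If a cluster starts with exactly k
-- occurrences at shift 2 from each other, it reads a₁ b₁ … a_k b_k a_{k+1} ρ, where ρ is again a
-- cluster (or a single entry) and a₁ < … < a_{k+1} < min ρ = ρ₁ < b_k < … < b₁. Removing the k + 2
-- smallest entries one after another leaves b₁ … b_k free to be any k of the other n - k - 2 entries.

open import Defs
open import Level using (Level; 0ℓ)
open import Algebra.Bundles using (CommutativeSemiring; CommutativeRing)
open import Data.Bool as Bool using (Bool; true; false; T; _∧_; if_then_else_)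
open import Data.Bool.ListAction using (all)
import Data.Bool.Properties as Bool
open import Data.Empty using (⊥)
open import Data.Integer as ℤ using (ℤ; -[1+_])
import Data.Integer.Properties as ℤ
open import Data.Nat as ℕ using (ℕ; zero; suc; _∸_; _≤_; _<_; _≡ᵇ_; _≤ᵇ_; _<ᵇ_; _≤?_; _<?_; z≤n; s≤s)
import Data.Nat.Properties as ℕ
open import Data.Nat.Combinatorics using (_C_; nCk+nC[k+1]≡[n+1]C[k+1]; k>n⇒nCk≡0)
open import Data.Nat.Solver using (module +-*-Solver)
open import Data.List
  using (List; []; _∷_; _++_; map; concatMap; filter; foldr; length; upTo; applyUpTo; zip; drop; take)
import Data.List.Properties as List
open import Data.List.Membership.Propositional using (_∈_; _∉_; find; lose)
open import Data.List.Membership.Propositional.Properties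
  using (∈-map⁺; ∈-map⁻; ∈-concatMap⁺; ∈-concatMap⁻; ∈-∃++; ∈-filter⁺; ∈-filter⁻; ∈-applyUpTo⁻; ∈-upTo⁻)
open import Data.List.Membership.Propositional.Properties.WithK using (unique∧set⇒bag)
open import Data.List.Relation.Unary.Any as Any using (Any; here; there)
import Data.List.Relation.Unary.Any.Properties as Any
open import Data.List.Relation.Unary.All as All using (All; []; _∷_)
import Data.List.Relation.Unary.All.Properties as All
open import Data.List.Relation.Unary.AllPairs as AllPairs using (AllPairs; []; _∷_)
import Data.List.Relation.Unary.AllPairs.Properties as AllPairs
open import Data.List.Relation.Unary.Unique.Propositional using (Unique)
import Data.List.Relation.Unary.Unique.Propositional.Properties as Unique
open import Data.List.Relation.Binary.BagAndSetEquality using (∼bag⇒↭)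
open import Data.List.Relation.Binary.Sublist.Propositional using (_⊆_; []; _∷_; _∷ʳ_)
open import Data.List.Relation.Binary.Sublist.Propositional.Properties using (All-resp-⊆)
open import Data.List.Relation.Binary.Permutation.Propositional as ↭ using (_↭_; ↭-sym)
import Data.List.Relation.Binary.Permutation.Propositional.Properties as ↭
open import Data.List.Relation.Binary.Permutation.Propositional.Properties
  using (∈-resp-↭; All-resp-↭; ↭-length; shift)
open import Data.Product using (_×_; _,_; proj₁; proj₂; ∃)
open import Data.Sum using (_⊎_; inj₁; inj₂)
open import Function using (_∘_; id)
open import Function.Bundles using (mk⇔; Equivalence)
open import Relation.Nullary using (¬_; Dec; yes; no; contradiction)
open import Relation.Binary.PropositionalEquality as ≡
  using (_≡_; _≢_; refl; sym; trans; cong; cong₂; subst; module ≡-Reasoning)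

-- Sums over arrangements

-- The two pieces of a cut permutation are arrangements of complementary subsets of 1, ..., n, not
-- permutations, so sums run over arrangements of an arbitrary list of letters; sorted lists of
-- equal length are identified only at the end. The semiring is left open because the machinery
-- serves twice: over the natural numbers for counting clusters, and over the ring of `EGF` for
-- weights in t. Marks enter through t = 1 + u with u = t - 1: an occurrence is either unmarked or
-- marked with weight u. Inserting a new least letter usually offers no choice. A cluster begins
-- with its least entry, so each of a₁, ..., a_{k+1}, ρ₁ has a forced position at the moment it is
-- the least letter left, and the sum over insertions has at most one nonzero term. A choice remains
-- only for the word b₁ ... b_k followed by the rest of ρ: which k letters form the descending
-- prefix. This is the source of the binomial coefficient.

inserts : {A : Set} → A → List A → List (List A)
inserts x []       = (x ∷ []) ∷ []
inserts x (y ∷ ys) = (x ∷ y ∷ ys) ∷ map (y ∷_) (inserts x ys)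

arrangements : {A : Set} → List A → List (List A)
arrangements []       = [] ∷ []
arrangements (x ∷ xs) = concatMap (inserts x) (arrangements xs)

∈-inserts⇒↭ : {A : Set} {x : A} {w : List A} (ys : List A) → w ∈ inserts x ys → w ↭ x ∷ ys
∈-inserts⇒↭ []       (here refl) = ↭.refl
∈-inserts⇒↭ (y ∷ ys) (here refl) = ↭.refl
∈-inserts⇒↭ (y ∷ ys) (there w∈) with ∈-map⁻ (y ∷_) w∈
... | v , v∈ , refl = ↭.trans (↭.prep y (∈-inserts⇒↭ ys v∈)) (↭.swap y _ ↭.refl)

∈-arrangements⇒↭ : {A : Set} {w : List A} (L : List A) → w ∈ arrangements L → w ↭ L
∈-arrangements⇒↭ []      (here refl) = ↭.refl
∈-arrangements⇒↭ (x ∷ L) w∈ with find (∈-concatMap⁻ (inserts x) {xs = arrangements L} w∈)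
... | v , v∈ , w∈v = ↭.trans (∈-inserts⇒↭ v w∈v) (↭.prep x (∈-arrangements⇒↭ L v∈))

Sorted : List ℕ → Set
Sorted = AllPairs _<_

AllPairs-⊆ : {A : Set} {R : A → A → Set} {xs ys : List A} → xs ⊆ ys → AllPairs R ys → AllPairs R xs
AllPairs-⊆ []         []       = []
AllPairs-⊆ (y ∷ʳ p)   (_ ∷ rs) = AllPairs-⊆ p rs
AllPairs-⊆ (refl ∷ p) (r ∷ rs) = All-resp-⊆ p r ∷ AllPairs-⊆ p rs

<⇒<ᵇ≡true : ∀ {m n} → m < n → (m <ᵇ n) ≡ true
<⇒<ᵇ≡true {m} {n} m<n with m <ᵇ n | ℕ.<⇒<ᵇ m<n
... | true | _ = refl

≥⇒<ᵇ≡false : ∀ {m n} → n ℕ.≤ m → (m <ᵇ n) ≡ false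
≥⇒<ᵇ≡false {m} {n} n≤m with m <ᵇ n in eq
... | false = refl
... | true with () ← ℕ.<⇒≱ (ℕ.<ᵇ⇒< m n (subst T (sym eq) _)) n≤m

-- A pair of order-isomorphic words is one word of pairs, so that an arrangement acts on both at once.
SameOrder : List (ℕ × ℕ) → Set
SameOrder zs = ∀ {p q} → p ∈ zs → q ∈ zs → (proj₁ p <ᵇ proj₁ q) ≡ (proj₂ p <ᵇ proj₂ q)

sorted⇒sameOrder : ∀ {xs ys} → Sorted xs → Sorted ys → SameOrder (zip xs ys)
sorted⇒sameOrder []       _        ()
sorted⇒sameOrder (_ ∷ _)  []       ()
sorted⇒sameOrder {x ∷ xs} {y ∷ ys} (x< ∷ sx) (y< ∷ sy) = go
  where
  proj₁∈ : ∀ {p} {us vs : List ℕ} → p ∈ zip us vs → proj₁ p ∈ us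
  proj₁∈ {us = _ ∷ _} {_ ∷ _} (here refl) = here refl
  proj₁∈ {us = _ ∷ _} {_ ∷ _} (there p∈)    = there (proj₁∈ p∈)
  proj₂∈ : ∀ {p} {us vs : List ℕ} → p ∈ zip us vs → proj₂ p ∈ vs
  proj₂∈ {us = _ ∷ _} {_ ∷ _} (here refl) = here refl
  proj₂∈ {us = _ ∷ _} {_ ∷ _} (there p∈)    = there (proj₂∈ p∈)
  go : SameOrder ((x , y) ∷ zip xs ys)
  go (here refl) (here refl) = trans (≥⇒<ᵇ≡false {x} ℕ.≤-refl) (sym (≥⇒<ᵇ≡false {y} ℕ.≤-refl))
  go (here refl) (there q∈) =
    trans (<⇒<ᵇ≡true (All.lookup x< (proj₁∈ q∈))) (sym (<⇒<ᵇ≡true (All.lookup y< (proj₂∈ q∈))))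
  go (there p∈) (here refl) =
    trans (≥⇒<ᵇ≡false (ℕ.<⇒≤ (All.lookup x< (proj₁∈ p∈))))
            (sym (≥⇒<ᵇ≡false (ℕ.<⇒≤ (All.lookup y< (proj₂∈ p∈)))))
  go (there p∈) (there q∈) = sorted⇒sameOrder sx sy p∈ q∈

map-proj₁-zip : {A B : Set} (xs : List A) (ys : List B) → length xs ≡ length ys → map proj₁ (zip xs ys) ≡ xs
map-proj₁-zip []       []       _  = refl
map-proj₁-zip (x ∷ xs) (y ∷ ys) eq = cong (x ∷_) (map-proj₁-zip xs ys (ℕ.suc-injective eq))

map-proj₂-zip : {A B : Set} (xs : List A) (ys : List B) → length xs ≡ length ys → map proj₂ (zip xs ys) ≡ ys
map-proj₂-zip []       []       _  = refl
map-proj₂-zip (x ∷ xs) (y ∷ ys) eq = cong (y ∷_) (map-proj₂-zip xs ys (ℕ.suc-injective eq))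

map-upTo-suc : {a : Level} {A : Set a} (f : ℕ → A) (n : ℕ) → map f (applyUpTo suc n) ≡ map (f ∘ suc) (upTo n)
map-upTo-suc f n = trans (List.map-applyUpTo suc f n) (sym (List.map-upTo (f ∘ suc) n))

module Weighted {c ℓ : Level} (S : CommutativeSemiring c ℓ) where

  open CommutativeSemiring S renaming (refl to ≈-refl; sym to ≈-sym; trans to ≈-trans) hiding (zero)
  open import Relation.Binary.Reasoning.Setoid setoid
  open import Algebra.Solver.Ring.NaturalCoefficients.Default S
  open import Data.List.Relation.Binary.Permutation.Setoid.Properties setoid using (foldr-commMonoid)

  private
    variable
      A B : Set

  sumOver : List A → (A → Carrier) → Carrier
  sumOver xs f = foldr _+_ 0# (map f xs)

  sumOver-cong : (xs : List A) {f g : A → Carrier} → (∀ {x} → x ∈ xs → f x ≈ g x) → sumOver xs f ≈ sumOver xs g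
  sumOver-cong []       h = ≈-refl
  sumOver-cong (x ∷ xs) h = +-cong (h (here refl)) (sumOver-cong xs (h ∘ there))

  sumOver-0 : (xs : List A) {f : A → Carrier} → (∀ {x} → x ∈ xs → f x ≈ 0#) → sumOver xs f ≈ 0#
  sumOver-0 []       h = ≈-refl
  sumOver-0 (x ∷ xs) h = ≈-trans (+-cong (h (here refl)) (sumOver-0 xs (h ∘ there))) (+-identityˡ 0#)

  sumOver-+ : (xs : List A) (f g : A → Carrier) → sumOver xs (λ x → f x + g x) ≈ sumOver xs f + sumOver xs g
  sumOver-+ []       f g = ≈-sym (+-identityˡ 0#)
  sumOver-+ (x ∷ xs) f g = ≈-trans (+-congˡ (sumOver-+ xs f g))
    (solve 4 (λ a b c d → (a :+ b) :+ (c :+ d) := (a :+ c) :+ (b :+ d)) ≈-refl _ _ _ _)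

  sumOver-*ˡ : (xs : List A) (k : Carrier) (f : A → Carrier) → sumOver xs (λ x → k * f x) ≈ k * sumOver xs f
  sumOver-*ˡ []       k f = ≈-sym (zeroʳ k)
  sumOver-*ˡ (x ∷ xs) k f = ≈-trans (+-congˡ (sumOver-*ˡ xs k f)) (≈-sym (distribˡ k _ _))

  sumOver-++ : (xs ys : List A) (f : A → Carrier) → sumOver (xs ++ ys) f ≈ sumOver xs f + sumOver ys f
  sumOver-++ []       ys f = ≈-sym (+-identityˡ _)
  sumOver-++ (x ∷ xs) ys f = ≈-trans (+-congˡ (sumOver-++ xs ys f)) (≈-sym (+-assoc _ _ _))

  sumOver-map : (g : A → B) (xs : List A) (f : B → Carrier) → sumOver (map g xs) f ≡ sumOver xs (f ∘ g)
  sumOver-map g xs f = cong (foldr _+_ 0#) (sym (List.map-∘ xs))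

  sumOver-concatMap : (g : A → List B) (xs : List A) (f : B → Carrier) →
    sumOver (concatMap g xs) f ≈ sumOver xs (λ x → sumOver (g x) f)
  sumOver-concatMap g []       f = ≈-refl
  sumOver-concatMap g (x ∷ xs) f =
    ≈-trans (sumOver-++ (g x) (concatMap g xs) f) (+-congˡ (sumOver-concatMap g xs f))

  sumOver-swap : (xs : List A) (ys : List B) (f : A → B → Carrier) →
    sumOver xs (λ x → sumOver ys (f x)) ≈ sumOver ys (λ y → sumOver xs (λ x → f x y))
  sumOver-swap []       ys f = ≈-sym (sumOver-0 ys λ _ → ≈-refl)
  sumOver-swap (x ∷ xs) ys f = ≈-trans (+-congˡ (sumOver-swap xs ys f)) (≈-sym (sumOver-+ ys (f x) _))

  sumOver-↭ : {xs ys : List A} (f : A → Carrier) → xs ↭ ys → sumOver xs f ≈ sumOver ys f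
  sumOver-↭ f p = foldr-commMonoid +-isCommutativeMonoid (↭.↭⇒↭ₛ′ isEquivalence (↭.map⁺ f p))

  sumOver-upTo-suc : (n : ℕ) (f : ℕ → Carrier) → sumOver (upTo (suc n)) f ≡ f 0 + sumOver (upTo n) (f ∘ suc)
  sumOver-upTo-suc n f = cong (λ l → f 0 + foldr _+_ 0# l) (map-upTo-suc f n)

  ins : A → (List A → Carrier) → List A → Carrier
  ins x F σ = sumOver (inserts x σ) F

  ins-∷ : (x : A) (F : List A → Carrier) (y : A) (σ : List A) →
    ins x F (y ∷ σ) ≡ F (x ∷ y ∷ σ) + ins x (F ∘ (y ∷_)) σ
  ins-∷ x F y σ = cong (F (x ∷ y ∷ σ) +_) (sumOver-map (y ∷_) (inserts x σ) F)

  total : List A → (List A → Carrier) → Carrier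
  total L F = sumOver (arrangements L) F

  total-cong : (L : List A) {F G : List A → Carrier} → (∀ {σ} → σ ↭ L → F σ ≈ G σ) → total L F ≈ total L G
  total-cong L h = sumOver-cong (arrangements L) (h ∘ ∈-arrangements⇒↭ L)

  total-∷ : (x : A) (L : List A) (F : List A → Carrier) → total (x ∷ L) F ≈ total L (ins x F)
  total-∷ x L F = sumOver-concatMap (inserts x) (arrangements L) F

  ins-map : (g : A → B) (x : A) (F : List B → Carrier) (σ : List A) →
    ins (g x) F (map g σ) ≈ ins x (F ∘ map g) σ
  ins-map g x F []      = ≈-refl
  ins-map g x F (y ∷ σ) = begin
    ins (g x) F (map g (y ∷ σ))                              ≡⟨ ins-∷ (g x) F (g y) (map g σ) ⟩
    F (map g (x ∷ y ∷ σ)) + ins (g x) (F ∘ (g y ∷_)) (map g σ)  ≈⟨ +-congˡ (ins-map g x (F ∘ (g y ∷_)) σ) ⟩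
    F (map g (x ∷ y ∷ σ)) + ins x (F ∘ map g ∘ (y ∷_)) σ     ≡⟨ ins-∷ x (F ∘ map g) y σ ⟨
    ins x (F ∘ map g) (y ∷ σ)                                ∎

  total-map : (g : A → B) (L : List A) (F : List B → Carrier) → total (map g L) F ≈ total L (F ∘ map g)
  total-map g []      F = ≈-refl
  total-map g (x ∷ L) F = begin
    total (g x ∷ map g L) F          ≈⟨ total-∷ (g x) (map g L) F ⟩
    total (map g L) (ins (g x) F)    ≈⟨ total-map g L (ins (g x) F) ⟩
    total L (ins (g x) F ∘ map g)    ≈⟨ total-cong L (λ {σ} _ → ins-map g x F σ) ⟩
    total L (ins x (F ∘ map g))      ≈⟨ total-∷ x L (F ∘ map g) ⟨
    total (x ∷ L) (F ∘ map g)        ∎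

  OrderInvariant : (List ℕ → Carrier) → Set ℓ
  OrderInvariant F = ∀ zs → SameOrder zs → F (map proj₁ zs) ≈ F (map proj₂ zs)

  -- Zipping the two sorted lists gives letters that are pairs. Every arrangement of them projects
  -- to an arrangement of `L` and one of `M`, and these two are order-isomorphic.
  total-sorted : {F : List ℕ → Carrier} → OrderInvariant F → {L M : List ℕ} →
    Sorted L → Sorted M → length L ≡ length M → total L F ≈ total M F
  total-sorted {F} inv {L} {M} sL sM eq = begin
    total L F                  ≡⟨ cong (λ l → total l F) (map-proj₁-zip L M eq) ⟨
    total (map proj₁ Z) F      ≈⟨ total-map proj₁ Z F ⟩
    total Z (F ∘ map proj₁)    ≈⟨ total-cong Z (λ σ↭Z → inv _ λ p q →
                                    sorted⇒sameOrder sL sM (∈-resp-↭ σ↭Z p) (∈-resp-↭ σ↭Z q)) ⟩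
    total Z (F ∘ map proj₂)    ≈⟨ total-map proj₂ Z F ⟨
    total (map proj₂ Z) F      ≡⟨ cong (λ l → total l F) (map-proj₂-zip L M eq) ⟩
    total M F                  ∎
    where Z = zip L M

  -- Concatenation product: the sum of F α * G β over all cuts σ = αβ, empty sides included. Letters
  -- of the prefix are absorbed into `F`, so the laws below are inductions on σ with `F` varying.
  conv : (F G : List A → Carrier) → List A → Carrier
  conv F G []      = F [] * G []
  conv F G (x ∷ σ) = F [] * G (x ∷ σ) + conv (F ∘ (x ∷_)) G σ

  conv-congˡ : {F F′ : List A → Carrier} (G : List A → Carrier) →
    (∀ σ → F σ ≈ F′ σ) → ∀ σ → conv F G σ ≈ conv F′ G σ
  conv-congˡ G h []      = *-congʳ (h [])
  conv-congˡ G h (x ∷ σ) = +-cong (*-congʳ (h [])) (conv-congˡ G (h ∘ (x ∷_)) σ)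

  conv-+ˡ : (F F′ G : List A → Carrier) → ∀ σ → conv (λ τ → F τ + F′ τ) G σ ≈ conv F G σ + conv F′ G σ
  conv-+ˡ F F′ G []      = distribʳ _ _ _
  conv-+ˡ F F′ G (x ∷ σ) = ≈-trans (+-cong (distribʳ _ _ _) (conv-+ˡ (F ∘ (x ∷_)) (F′ ∘ (x ∷_)) G σ))
    (solve 4 (λ a b c d → (a :+ b) :+ (c :+ d) := (a :+ c) :+ (b :+ d)) ≈-refl _ _ _ _)

  conv-*ˡ : (k : Carrier) (F G : List A → Carrier) → ∀ σ → conv (λ τ → k * F τ) G σ ≈ k * conv F G σ
  conv-*ˡ k F G []      = *-assoc _ _ _
  conv-*ˡ k F G (x ∷ σ) = ≈-trans (+-cong (*-assoc _ _ _) (conv-*ˡ k (F ∘ (x ∷_)) G σ)) (≈-sym (distribˡ k _ _))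

  conv-0ˡ : {F : List A → Carrier} (G : List A → Carrier) → (∀ σ → F σ ≈ 0#) → ∀ σ → conv F G σ ≈ 0#
  conv-0ˡ G h []      = ≈-trans (*-congʳ (h [])) (zeroˡ _)
  conv-0ˡ G h (x ∷ σ) =
    ≈-trans (+-cong (≈-trans (*-congʳ (h [])) (zeroˡ _)) (conv-0ˡ G (h ∘ (x ∷_)) σ)) (+-identityˡ 0#)

  -- An entry inserted into a cut word lands on one of the two sides of the cut.
  ins-conv : (x : A) (F G : List A → Carrier) (σ : List A) →
    ins x (conv F G) σ ≈ conv (ins x F) G σ + conv F (ins x G) σ
  ins-conv x F G [] =
    solve 4 (λ f fx g gx → (f :* gx :+ fx :* g) :+ con 0 := (fx :+ con 0) :* g :+ f :* (gx :+ con 0))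
      ≈-refl (F []) (F (x ∷ [])) (G []) (G (x ∷ []))
  ins-conv x F G (y ∷ σ) = begin
    ins x (conv F G) (y ∷ σ)
      ≡⟨ ins-∷ x (conv F G) y σ ⟩
    conv F G (x ∷ y ∷ σ) + ins x (λ τ → F [] * G (y ∷ τ) + conv (F ∘ (y ∷_)) G τ) σ
      ≈⟨ +-congˡ (sumOver-+ (inserts x σ) _ _) ⟩
    conv F G (x ∷ y ∷ σ) + (ins x (λ τ → F [] * G (y ∷ τ)) σ + ins x (conv (F ∘ (y ∷_)) G) σ)
      ≈⟨ +-congˡ (+-cong (sumOver-*ˡ (inserts x σ) (F []) _) (ins-conv x (F ∘ (y ∷_)) G σ)) ⟩
    (F [] * G (x ∷ y ∷ σ) + (F (x ∷ []) * G (y ∷ σ) + conv (F ∘ (x ∷_) ∘ (y ∷_)) G σ)) +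
      (F [] * ins x (G ∘ (y ∷_)) σ + (conv (ins x (F ∘ (y ∷_))) G σ + conv (F ∘ (y ∷_)) (ins x G) σ))
      ≈⟨ solve 8 (λ f g₀ fx g c₁ i c₂ c₃ →
           (f :* g₀ :+ (fx :* g :+ c₁)) :+ (f :* i :+ (c₂ :+ c₃)) :=
           ((fx :+ con 0) :* g :+ (c₁ :+ c₂)) :+ (f :* (g₀ :+ i) :+ c₃))
           ≈-refl _ _ _ _ _ _ _ _ ⟩
    (ins x F [] * G (y ∷ σ) + (conv (F ∘ (x ∷_) ∘ (y ∷_)) G σ + conv (ins x (F ∘ (y ∷_))) G σ)) +
      (F [] * (G (x ∷ y ∷ σ) + ins x (G ∘ (y ∷_)) σ) + conv (F ∘ (y ∷_)) (ins x G) σ)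
      ≈⟨ +-cong (+-congˡ (conv-+ˡ _ _ G σ)) (+-congʳ (*-congˡ (reflexive (ins-∷ x G y σ)))) ⟨
    (ins x F [] * G (y ∷ σ) + conv (λ τ → F (x ∷ y ∷ τ) + ins x (F ∘ (y ∷_)) τ) G σ) +
      conv F (ins x G) (y ∷ σ)
      ≈⟨ +-congʳ (+-congˡ (conv-congˡ G (λ τ → reflexive (ins-∷ x F y τ)) σ)) ⟨
    conv (ins x F) G (y ∷ σ) + conv F (ins x G) (y ∷ σ) ∎

  -- The counterpart of `conv` for lists of letters: each letter goes to one of two complementary
  -- sublists, and all distributions are summed.
  splits : (f g : List A → Carrier) → List A → Carrier
  splits f g []      = f [] * g []
  splits f g (x ∷ L) = splits (f ∘ (x ∷_)) g L + splits f (g ∘ (x ∷_)) L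

  splits-cong : {f f′ g g′ : List A → Carrier} → (∀ L → f L ≈ f′ L) → (∀ L → g L ≈ g′ L) →
    ∀ L → splits f g L ≈ splits f′ g′ L
  splits-cong hf hg []      = *-cong (hf []) (hg [])
  splits-cong hf hg (x ∷ L) = +-cong (splits-cong (hf ∘ (x ∷_)) hg L) (splits-cong hf (hg ∘ (x ∷_)) L)

  -- Iterating `ins-conv` decides for each letter on which side of the cut it lies; the letters of
  -- each side are then arranged independently.
  total-conv : (F G : List A → Carrier) (L : List A) →
    total L (conv F G) ≈ splits (λ M → total M F) (λ M → total M G) L
  total-conv F G [] =
    solve 2 (λ f g → f :* g :+ con 0 := (f :+ con 0) :* (g :+ con 0)) ≈-refl (F []) (G [])
  total-conv F G (x ∷ L) = begin
    total (x ∷ L) (conv F G)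
      ≈⟨ total-∷ x L (conv F G) ⟩
    total L (ins x (conv F G))
      ≈⟨ total-cong L (λ {σ} _ → ins-conv x F G σ) ⟩
    total L (λ σ → conv (ins x F) G σ + conv F (ins x G) σ)
      ≈⟨ sumOver-+ (arrangements L) _ _ ⟩
    total L (conv (ins x F) G) + total L (conv F (ins x G))
      ≈⟨ +-cong (total-conv (ins x F) G L) (total-conv F (ins x G) L) ⟩
    splits (λ M → total M (ins x F)) (λ M → total M G) L + splits (λ M → total M F) (λ M → total M (ins x G)) L
      ≈⟨ +-cong (splits-cong (λ M → total-∷ x M F) (λ _ → ≈-refl) L)
                (splits-cong (λ _ → ≈-refl) (λ M → total-∷ x M G) L) ⟨
    splits (λ M → total M F) (λ M → total M G) (x ∷ L) ∎

  -- Binomial convolution, the product rule for coefficients of exponential generating functions.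
  -- The Leibniz recursion makes it match `splits` step by step; `binom-sum` brings back the
  -- binomial coefficients.
  binom : (f g : ℕ → Carrier) → ℕ → Carrier
  binom f g zero    = f 0 * g 0
  binom f g (suc n) = binom (f ∘ suc) g n + binom f (g ∘ suc) n

  binom-comm : (f g : ℕ → Carrier) (n : ℕ) → binom f g n ≈ binom g f n
  binom-comm f g zero    = *-comm _ _
  binom-comm f g (suc n) =
    ≈-trans (+-cong (binom-comm (f ∘ suc) g n) (binom-comm f (g ∘ suc) n)) (+-comm _ _)

  -- The hypotheses are confined to sublists of `L` because totals of order-invariant weights are
  -- known to depend on the length alone for sorted lists, and sublists inherit sortedness.
  splits-length : {f g : List A → Carrier} {f′ g′ : ℕ → Carrier} (L : List A) →
    (∀ {M} → M ⊆ L → f M ≈ f′ (length M)) → (∀ {M} → M ⊆ L → g M ≈ g′ (length M)) →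
    splits f g L ≈ binom f′ g′ (length L)
  splits-length []      hf hg = *-cong (hf []) (hg [])
  splits-length (x ∷ L) hf hg =
    +-cong (splits-length L (λ s → hf (refl ∷ s)) (λ s → hg (x ∷ʳ s)))
           (splits-length L (λ s → hf (x ∷ʳ s)) (λ s → hg (refl ∷ s)))

-- Permutations as arrangements of 1, …, n

-- The map `g` recovers from an entry the block it lies in, so distinct blocks are disjoint.
concatMap-unique : {A B : Set} (f : A → List B) (g : B → A) (xs : List A) →
  (∀ {x y} → x ∈ xs → y ∈ f x → g y ≡ x) → (∀ {x} → x ∈ xs → Unique (f x)) →
  Unique xs → Unique (concatMap f xs)
concatMap-unique f g []       inv uf []         = []
concatMap-unique f g (x ∷ xs) inv uf (x∉ ∷ uxs) =
  Unique.++⁺ (uf (here refl)) (concatMap-unique f g xs (inv ∘ there) (uf ∘ there) uxs) disjoint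
  where
  disjoint : ∀ {y} → y ∈ f x × y ∈ concatMap f xs → _
  disjoint (y∈ , y∈′) with find (∈-concatMap⁻ f {xs = xs} y∈′)
  ... | x′ , x′∈ , y∈″ = All.lookup x∉ x′∈ (trans (sym (inv (here refl) y∈)) (inv (there x′∈) y∈″))

-- Serves as left inverse of insertion: if x does not occur in σ, it recovers σ from every word of
-- `inserts x σ`.
remove : ℕ → List ℕ → List ℕ
remove x []       = []
remove x (y ∷ ys) with x ℕ.≟ y
... | yes _ = ys
... | no  _ = y ∷ remove x ys

remove-insert : ∀ {x w} (σ : List ℕ) → x ∉ σ → w ∈ inserts x σ → remove x w ≡ σ
remove-insert {x} []      x∉ (here refl) with x ℕ.≟ x
... | yes _  = refl
... | no x≢x = contradiction refl x≢x
remove-insert {x} (y ∷ σ) x∉ (here refl) with x ℕ.≟ x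
... | yes _  = refl
... | no x≢x = contradiction refl x≢x
remove-insert {x} (y ∷ σ) x∉ (there w∈) with ∈-map⁻ (y ∷_) w∈
... | v , v∈ , refl with x ℕ.≟ y
...   | yes refl = contradiction (here refl) x∉
...   | no  _      = cong (y ∷_) (remove-insert σ (x∉ ∘ there) v∈)

inserts-unique : ∀ {x} (σ : List ℕ) → x ∉ σ → Unique (inserts x σ)
inserts-unique     []      x∉ = [] ∷ []
inserts-unique {x} (y ∷ σ) x∉ =
  All.tabulate head≢ ∷ Unique.map⁺ List.∷-injectiveʳ (inserts-unique σ (x∉ ∘ there))
  where
  head≢ : ∀ {w} → w ∈ map (y ∷_) (inserts x σ) → x ∷ y ∷ σ ≢ w
  head≢ w∈ eq with ∈-map⁻ (y ∷_) w∈
  head≢ w∈ refl | _ , _ , refl = x∉ (here refl)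

arrangements-unique : (L : List ℕ) → Unique L → Unique (arrangements L)
arrangements-unique []      []       = [] ∷ []
arrangements-unique (x ∷ L) (x∉ ∷ u) =
  concatMap-unique (inserts x) (remove x) (arrangements L)
    (λ σ∈ → remove-insert _ (x∉σ σ∈)) (λ σ∈ → inserts-unique _ (x∉σ σ∈)) (arrangements-unique L u)
  where
  x∉σ : ∀ {σ} → σ ∈ arrangements L → x ∉ σ
  x∉σ σ∈ x∈σ = All.lookup x∉ (∈-resp-↭ (∈-arrangements⇒↭ L σ∈) x∈σ) refl

inserts-++ : {A : Set} {x : A} (us : List A) {vs : List A} → us ++ x ∷ vs ∈ inserts x (us ++ vs)
inserts-++ []       {[]}     = here refl
inserts-++ []       {_ ∷ _}  = here refl
inserts-++ (u ∷ us)          = there (∈-map⁺ (u ∷_) (inserts-++ us))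

↭⇒∈-arrangements : {A : Set} (L : List A) {w : List A} → L ↭ w → w ∈ arrangements L
↭⇒∈-arrangements [] p with ↭-length p
↭⇒∈-arrangements [] {[]} p | _ = here refl
↭⇒∈-arrangements (x ∷ L) p with ∈-∃++ (∈-resp-↭ p (here refl))
... | us , vs , refl =
  ∈-concatMap⁺ (inserts x) (lose (↭⇒∈-arrangements L (↭.drop-∷ (↭.trans p (shift x us vs)))) (inserts-++ us))

-- Pigeonhole. `isPerm` tests only the length and the presence of 1, ..., n; this excludes repeated
-- and foreign entries.
unique-⊆⇒↭ : {A : Set} (xs ys : List A) → Unique xs → (∀ {x} → x ∈ xs → x ∈ ys) →
  length ys ≡ length xs → xs ↭ ys
unique-⊆⇒↭ []       []      u        sub eq = ↭.refl
unique-⊆⇒↭ (x ∷ xs) ys      (x∉ ∷ u) sub eq with ∈-∃++ (sub (here refl))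
... | us , vs , refl = ↭.trans (↭.prep x (unique-⊆⇒↭ xs (us ++ vs) u sub′ eq′)) (↭-sym (shift x us vs))
  where
  sub′ : ∀ {z} → z ∈ xs → z ∈ us ++ vs
  sub′ z∈ with ∈-resp-↭ (shift x us vs) (sub (there z∈))
  ... | here refl = contradiction refl (All.lookup x∉ z∈)
  ... | there z∈′   = z∈′
  eq′ : length (us ++ vs) ≡ length xs
  eq′ = ℕ.suc-injective (trans (sym (↭-length (shift x us vs))) eq)

range-length : (n : ℕ) → length (range n) ≡ n
range-length n = trans (List.length-map suc (upTo n)) (List.length-upTo n)

range-sorted : (n : ℕ) → Sorted (range n)
range-sorted n = AllPairs.map⁺ (AllPairs.applyUpTo⁺₁ id n (λ i<j _ → ℕ.s≤s i<j))

range-unique : (n : ℕ) → Unique (range n)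
range-unique n = AllPairs.map ℕ.<⇒≢ (range-sorted n)

words-unique : (n k : ℕ) → Unique (words n k)
words-unique n zero    = [] ∷ []
words-unique n (suc k) =
  concatMap-unique (λ w → map (_∷ w) (range n)) (drop 1) (words n k) tail≡
    (λ _ → Unique.map⁺ List.∷-injectiveˡ (range-unique n)) (words-unique n k)
  where
  tail≡ : ∀ {w v} → w ∈ words n k → v ∈ map (_∷ w) (range n) → drop 1 v ≡ w
  tail≡ {w} _ v∈ with ∈-map⁻ (_∷ w) v∈
  ... | _ , _ , refl = refl

∈-words : (n : ℕ) {w : List ℕ} → All (_∈ range n) w → w ∈ words n (length w)
∈-words n []                   = here refl
∈-words n {x ∷ w} (x∈ ∷ w⊆) =
  ∈-concatMap⁺ (λ v → map (_∷ v) (range n)) (lose (∈-words n w⊆) (∈-map⁺ (_∷ w) x∈))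

isPerm⇒↭ : (n : ℕ) (w : List ℕ) → isPerm n w ≡ true → range n ↭ w
isPerm⇒↭ n w eq with Equivalence.to Bool.T-∧ (subst T (sym eq) _)
... | len , covers = unique-⊆⇒↭ (range n) w (range-unique n) sub
        (trans (ℕ.≡ᵇ⇒≡ (length w) n len) (sym (range-length n)))
  where
  sub : ∀ {j} → j ∈ range n → j ∈ w
  sub {j} j∈ = Any.map (λ {x} → sym ∘ ℕ.≡ᵇ⇒≡ x j) (Any.any⁻ _ w (All.lookup (All.all⁺ _ (range n) covers) j∈))

↭⇒isPerm : (n : ℕ) (w : List ℕ) → range n ↭ w → isPerm n w ≡ true
↭⇒isPerm n w p = Equivalence.to Bool.T-≡ (Equivalence.from Bool.T-∧
  ( ℕ.≡⇒≡ᵇ (length w) n (trans (sym (↭-length p)) (range-length n))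
  , All.all⁻ _ (All.tabulate λ {j} j∈ →
      Any.any⁺ _ (Any.map (λ { {x} refl → ℕ.≡⇒≡ᵇ x x refl }) (∈-resp-↭ p j∈)))))

-- Both lists are free of repetitions and have the same members, so they agree as bags.
perms-↭ : (n : ℕ) → perms n ↭ arrangements (range n)
perms-↭ n = ∼bag⇒↭ (unique∧set⇒bag
  (Unique.filter⁺ (λ σ → isPerm n σ Bool.≟ true) (words-unique n n))
  (arrangements-unique (range n) (range-unique n))
  (mk⇔ to from))
  where
  to : ∀ {w} → w ∈ perms n → w ∈ arrangements (range n)
  to w∈ with ∈-filter⁻ (λ σ → isPerm n σ Bool.≟ true) {xs = words n n} w∈
  ... | _ , eq = ↭⇒∈-arrangements (range n) (isPerm⇒↭ n _ eq)
  from : ∀ {w} → w ∈ arrangements (range n) → w ∈ perms n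
  from {w} w∈ with ∈-arrangements⇒↭ (range n) w∈
  ... | p = ∈-filter⁺ (λ σ → isPerm n σ Bool.≟ true)
              (subst (λ k → w ∈ words n k) (trans (↭-length p) (range-length n))
                (∈-words n (All.tabulate (∈-resp-↭ p))))
              (↭⇒isPerm n w (↭-sym p))

-- Occurrences and clusters of 1423

module ℕW = Weighted ℕ.+-*-commutativeSemiring
open ℕW using () renaming (sumOver to ∑; total to count)

χ : Bool → ℕ
χ b = if b then 1 else 0

length-filter : {A : Set} (f : A → Bool) (xs : List A) →
  length (filter (λ x → f x Bool.≟ true) xs) ≡ ∑ xs (χ ∘ f)
length-filter f []       = refl
length-filter f (x ∷ xs) with f x
... | true  = cong suc (length-filter f xs)
... | false = length-filter f xs

inOrder : (a b c d : ℕ) → Bool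
inOrder a b c d = (a <ᵇ c) ∧ (c <ᵇ d) ∧ (d <ᵇ b)

<ᵇ≡true⇒< : ∀ {m n} → (m <ᵇ n) ≡ true → m < n
<ᵇ≡true⇒< {m} {n} eq = ℕ.<ᵇ⇒< m n (subst T (sym eq) _)

inOrder⇒< : ∀ {a b c d} → inOrder a b c d ≡ true → a < c × c < d × d < b
inOrder⇒< {a} {b} {c} {d} eq with a <ᵇ c in e₁ | c <ᵇ d in e₂ | d <ᵇ b in e₃
... | true | true | true = <ᵇ≡true⇒< e₁ , <ᵇ≡true⇒< e₂ , <ᵇ≡true⇒< e₃

length-filter-< : (x : ℕ) (s : List ℕ) → length (filter (_<? x) s) ≡ ∑ s (λ y → χ (y <ᵇ x))
length-filter-< x []      = refl
length-filter-< x (y ∷ s) with y <ᵇ x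
... | true  = cong suc (length-filter-< x s)
... | false = length-filter-< x s

-- For each entry `st` counts the smaller ones, and 1423 asks for the counts 0, 3, 1, 2. The count 3
-- at b gives c < b and d < b; then the count 2 at d forces c < d, and the count 1 at c forces a <
-- c.
st-1423 : (a b c d : ℕ) → (st (a ∷ b ∷ c ∷ d ∷ []) == p1423) ≡ inOrder a b c d
st-1423 a b c d
  rewrite length-filter-< a (a ∷ b ∷ c ∷ d ∷ []) | length-filter-< b (a ∷ b ∷ c ∷ d ∷ [])
        | length-filter-< c (a ∷ b ∷ c ∷ d ∷ []) | length-filter-< d (a ∷ b ∷ c ∷ d ∷ [])
        | ≥⇒<ᵇ≡false {a} ℕ.≤-refl | ≥⇒<ᵇ≡false {b} ℕ.≤-refl | ≥⇒<ᵇ≡false {c} ℕ.≤-refl | ≥⇒<ᵇ≡false {d} ℕ.≤-refl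
  = ⇔⇒≡ to from
  where
  -- The form to which the test against `p1423` reduces once self-comparisons are rewritten to false
  -- and the successors are cancelled.
  ranks : Bool
  ranks = (χ (b <ᵇ a) ℕ.+ (χ (c <ᵇ a) ℕ.+ (χ (d <ᵇ a) ℕ.+ 0)) ≡ᵇ 0)
    ∧ (χ (a <ᵇ b) ℕ.+ (χ (c <ᵇ b) ℕ.+ (χ (d <ᵇ b) ℕ.+ 0)) ≡ᵇ 3)
    ∧ (χ (a <ᵇ c) ℕ.+ (χ (b <ᵇ c) ℕ.+ (χ (d <ᵇ c) ℕ.+ 0)) ≡ᵇ 1)
    ∧ (χ (a <ᵇ d) ℕ.+ (χ (b <ᵇ d) ℕ.+ (χ (c <ᵇ d) ℕ.+ 0)) ≡ᵇ 2)
    ∧ true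
  ⇔⇒≡ : ∀ {x y} → (x ≡ true → y ≡ true) → (y ≡ true → x ≡ true) → x ≡ y
  ⇔⇒≡ {true}  {true}  f g = refl
  ⇔⇒≡ {true}  {false} f g = sym (f refl)
  ⇔⇒≡ {false} {true}  f g = g refl
  ⇔⇒≡ {false} {false} f g = refl
  three : ∀ x y z → T (χ x ℕ.+ (χ y ℕ.+ (χ z ℕ.+ 0)) ≡ᵇ 3) → x ≡ true × y ≡ true × z ≡ true
  three true  true  true  _ = refl , refl , refl
  three true  true  false ()
  three true  false true  ()
  three true  false false ()
  three false true  true  ()
  three false true  false ()
  three false false true  ()
  three false false false ()
  two : ∀ x y z → y ≡ false → T (χ x ℕ.+ (χ y ℕ.+ (χ z ℕ.+ 0)) ≡ᵇ 2) → x ≡ true × z ≡ true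
  two true  _ true  refl _ = refl , refl
  two true  _ false refl ()
  two false _ true  refl ()
  two false _ false refl ()
  one : ∀ x y z → y ≡ false → z ≡ false → T (χ x ℕ.+ (χ y ℕ.+ (χ z ℕ.+ 0)) ≡ᵇ 1) → x ≡ true
  one true  _ _ _    _    _ = refl
  one false _ _ refl refl ()
  ∧-elim : ∀ x {y} → T (x ∧ y) → T x × T y
  ∧-elim x = Equivalence.to Bool.T-∧
  to : ranks ≡ true → inOrder a b c d ≡ true
  to eq =
    let _  , h₁ = ∧-elim (χ (b <ᵇ a) ℕ.+ (χ (c <ᵇ a) ℕ.+ (χ (d <ᵇ a) ℕ.+ 0)) ≡ᵇ 0) (subst T (sym eq) _)
        rb , h₂ = ∧-elim (χ (a <ᵇ b) ℕ.+ (χ (c <ᵇ b) ℕ.+ (χ (d <ᵇ b) ℕ.+ 0)) ≡ᵇ 3) h₁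
        rc , h₃ = ∧-elim (χ (a <ᵇ c) ℕ.+ (χ (b <ᵇ c) ℕ.+ (χ (d <ᵇ c) ℕ.+ 0)) ≡ᵇ 1) h₂
        rd , _  = ∧-elim (χ (a <ᵇ d) ℕ.+ (χ (b <ᵇ d) ℕ.+ (χ (c <ᵇ d) ℕ.+ 0)) ≡ᵇ 2) h₃
        _ , c<b , d<b = three (a <ᵇ b) (c <ᵇ b) (d <ᵇ b) rb
        _ , c<d = two (a <ᵇ d) (b <ᵇ d) (c <ᵇ d) (≮ d b d<b) rd
        a<c = one (a <ᵇ c) (b <ᵇ c) (d <ᵇ c) (≮ c b c<b) (≮ c d c<d) rc
    in cong₂ _∧_ a<c (cong₂ _∧_ c<d d<b)
    where
    ≮ : ∀ x y → (x <ᵇ y) ≡ true → (y <ᵇ x) ≡ false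
    ≮ x y eq = ≥⇒<ᵇ≡false (ℕ.<⇒≤ (<ᵇ≡true⇒< {x} {y} eq))
  from : inOrder a b c d ≡ true → ranks ≡ true
  from eq with inOrder⇒< {a} {b} {c} {d} eq
  ... | a<c , c<d , d<b
    with ℕ.<-trans a<c c<d | ℕ.<-trans c<d d<b
  ... | a<d | c<b with ℕ.<-trans a<c c<b
  ... | a<b
    rewrite <⇒<ᵇ≡true a<c | <⇒<ᵇ≡true c<d | <⇒<ᵇ≡true d<b | <⇒<ᵇ≡true a<d | <⇒<ᵇ≡true c<b | <⇒<ᵇ≡true a<b
          | ≥⇒<ᵇ≡false (ℕ.<⇒≤ a<c) | ≥⇒<ᵇ≡false (ℕ.<⇒≤ c<d) | ≥⇒<ᵇ≡false (ℕ.<⇒≤ d<b)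
          | ≥⇒<ᵇ≡false (ℕ.<⇒≤ a<d) | ≥⇒<ᵇ≡false (ℕ.<⇒≤ c<b) | ≥⇒<ᵇ≡false (ℕ.<⇒≤ a<b) = refl

begins : List ℕ → Bool
begins (a ∷ b ∷ c ∷ d ∷ _) = inOrder a b c d
begins _                   = false

occursAt-drop : (σ : List ℕ) (i : ℕ) → occursAt (length σ) σ p1423 (suc i) ≡ begins (drop i σ)
occursAt-drop σ zero = go σ
  where
  go : ∀ σ → occursAt (length σ) σ p1423 1 ≡ begins σ
  go []                  = refl
  go (_ ∷ [])            = refl
  go (_ ∷ _ ∷ [])        = refl
  go (_ ∷ _ ∷ _ ∷ [])    = refl
  go (a ∷ b ∷ c ∷ d ∷ σ) = st-1423 a b c d
occursAt-drop []      (suc i) = refl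
occursAt-drop (x ∷ σ) (suc i) =
  trans (cong (_∧ (st (take 4 (drop i σ)) == p1423)) (≤ᵇ-suc (i ℕ.+ 4) (length σ))) (occursAt-drop σ i)
  where
  ≤ᵇ-suc : ∀ m n → (m <ᵇ suc n) ≡ (m ≤ᵇ n)
  ≤ᵇ-suc zero    n = refl
  ≤ᵇ-suc (suc m) n = refl

-- A word of length 1 counts as a 0-cluster, which is the convention c_{1,l} = δ_{0,l}.
clusters : List ℕ → ℕ → ℕ
clusters []                  q       = 0
clusters (a ∷ [])            zero    = 1
clusters (a ∷ [])            (suc q) = 0
clusters (a ∷ b ∷ [])        q       = 0
clusters (a ∷ b ∷ c ∷ [])    q       = 0
clusters (a ∷ b ∷ c ∷ d ∷ σ) zero    = 0
clusters (a ∷ b ∷ c ∷ d ∷ σ) (suc q) = if inOrder a b c d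
  then clusters (b ∷ c ∷ d ∷ σ) q ℕ.+ (clusters (c ∷ d ∷ σ) q ℕ.+ clusters (d ∷ σ) q)
  else 0

begins-sameOrder : ∀ zs → SameOrder zs → begins (map proj₁ zs) ≡ begins (map proj₂ zs)
begins-sameOrder []                  _ = refl
begins-sameOrder (_ ∷ [])            _ = refl
begins-sameOrder (_ ∷ _ ∷ [])        _ = refl
begins-sameOrder (_ ∷ _ ∷ _ ∷ [])    _ = refl
begins-sameOrder (_ ∷ _ ∷ _ ∷ _ ∷ _) h =
  cong₂ _∧_ (h (here refl) (there (there (here refl))))
    (cong₂ _∧_ (h (there (there (here refl))) (there (there (there (here refl)))))
               (h (there (there (there (here refl)))) (there (here refl))))

sameOrder-tail : ∀ {z zs} → SameOrder (z ∷ zs) → SameOrder zs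
sameOrder-tail h p q = h (there p) (there q)

clusters-orderInvariant : (q : ℕ) → ℕW.OrderInvariant (λ σ → clusters σ q)
clusters-orderInvariant q       []               _ = refl
clusters-orderInvariant zero    (_ ∷ [])         _ = refl
clusters-orderInvariant (suc q) (_ ∷ [])         _ = refl
clusters-orderInvariant q       (_ ∷ _ ∷ [])     _ = refl
clusters-orderInvariant q       (_ ∷ _ ∷ _ ∷ []) _ = refl
clusters-orderInvariant zero    (_ ∷ _ ∷ _ ∷ _ ∷ zs) _ = refl
clusters-orderInvariant (suc q) zs@(_ ∷ zs₁@(_ ∷ zs₂@(_ ∷ zs₃@(_ ∷ _)))) h =
  cong₂ (λ b x → if b then x else 0) (begins-sameOrder zs h)
    (cong₂ ℕ._+_ (clusters-orderInvariant q zs₁ h₁)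
      (cong₂ ℕ._+_ (clusters-orderInvariant q zs₂ h₂) (clusters-orderInvariant q zs₃ (sameOrder-tail h₂))))
  where
  h₁ : SameOrder zs₁
  h₁ = sameOrder-tail h
  h₂ : SameOrder zs₂
  h₂ = sameOrder-tail h₁

-- Clusters as chains of overlapping windows

∑-tuples : (n q : ℕ) (g : List (List ℕ × ℕ) → ℕ) →
  ∑ (tuples P1423 n (suc q)) g ≡ ∑ (range n) (λ i → ∑ (tuples P1423 n q) (λ t → g ((p1423 , i) ∷ t)))
∑-tuples n q g = begin
  ∑ (concatMap extend (tuples P1423 n q)) g
    ≡⟨ ℕW.sumOver-concatMap extend (tuples P1423 n q) g ⟩
  ∑ (tuples P1423 n q) (λ t → ∑ (extend t) g)
    ≡⟨ ℕW.sumOver-cong (tuples P1423 n q) (λ {t} _ → trans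
         (cong (λ l → ∑ l g) (List.++-identityʳ (map (λ i → (p1423 , i) ∷ t) (range n))))
         (ℕW.sumOver-map (λ i → (p1423 , i) ∷ t) (range n) g)) ⟩
  ∑ (tuples P1423 n q) (λ t → ∑ (range n) (λ i → g ((p1423 , i) ∷ t)))
    ≡⟨ ℕW.sumOver-swap (tuples P1423 n q) (range n) (λ t i → g ((p1423 , i) ∷ t)) ⟩
  ∑ (range n) (λ i → ∑ (tuples P1423 n q) (λ t → g ((p1423 , i) ∷ t))) ∎
  where
  open ≡-Reasoning
  extend : List (List ℕ × ℕ) → List (List (List ℕ × ℕ))
  extend t = concatMap (λ π → map (λ i → (π , i) ∷ t) (range n)) P1423

-- Windows of length 4 overlap exactly at the shifts 1, 2, 3; the bound on i keeps all three start
-- positions inside the range.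
∑-window : (i n : ℕ) (h : ℕ → ℕ) → i ℕ.+ 4 ≤ n →
  ∑ (upTo n) (λ j → if (i <ᵇ j) ∧ (j <ᵇ i ℕ.+ 4) then h j else 0) ≡ h (1 ℕ.+ i) ℕ.+ (h (2 ℕ.+ i) ℕ.+ h (3 ℕ.+ i))
∑-window zero (suc (suc (suc (suc n)))) h _ = cong (λ x → h 1 ℕ.+ (h 2 ℕ.+ x)) (begin
  h 3 ℕ.+ ∑ (applyUpTo (4 ℕ.+_) n) w   ≡⟨ cong (h 3 ℕ.+_) (ℕW.sumOver-0 (applyUpTo (4 ℕ.+_) n) outside) ⟩
  h 3 ℕ.+ 0                                    ≡⟨ ℕ.+-identityʳ (h 3) ⟩
  h 3                                        ∎)
  where
  open ≡-Reasoning
  w : ℕ → ℕ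
  w j = if (0 <ᵇ j) ∧ (j <ᵇ 4) then h j else 0
  outside : ∀ {j} → j ∈ applyUpTo (4 ℕ.+_) n → w j ≡ 0
  outside j∈ with ∈-applyUpTo⁻ (4 ℕ.+_) j∈
  ... | _ , _ , refl = refl
∑-window zero 0 h ()
∑-window zero 1 h (s≤s ())
∑-window zero 2 h (s≤s (s≤s ()))
∑-window zero 3 h (s≤s (s≤s (s≤s ())))
∑-window (suc i) (suc n) h (s≤s le) =
  trans (ℕW.sumOver-upTo-suc n (λ j → if (suc i <ᵇ j) ∧ (j <ᵇ suc i ℕ.+ 4) then h j else 0))
        (∑-window i n (h ∘ suc) le)

drop-suc : ∀ i (σ : List ℕ) {x ρ} → drop i σ ≡ x ∷ ρ → drop (suc i) σ ≡ ρ
drop-suc zero    (x ∷ σ) refl = refl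
drop-suc (suc i) (x ∷ σ) eq   = drop-suc i σ eq

length-drop-∷ : ∀ i (σ : List ℕ) {x ρ} → drop i σ ≡ x ∷ ρ → length σ ≡ i ℕ.+ length (x ∷ ρ)
length-drop-∷ zero    σ       refl = refl
length-drop-∷ (suc i) (x ∷ σ) eq   = cong suc (length-drop-∷ i σ eq)

+-cancelˡ-≡ᵇ : ∀ i m n → (i ℕ.+ m ≡ᵇ i ℕ.+ n) ≡ (m ≡ᵇ n)
+-cancelˡ-≡ᵇ zero    m n = refl
+-cancelˡ-≡ᵇ (suc i) m n = +-cancelˡ-≡ᵇ i m n

-- Here f stands for the pattern-matching lambda in isCluster, which has no name.
module CountTuples (σ : List ℕ) (f : List ℕ × ℕ → Bool)
                   (f-occursAt : ∀ i → f (p1423 , i) ≡ occursAt (length σ) σ p1423 i) where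

  n : ℕ
  n = length σ

  -- The start i is left free, unlike in `isCluster`, so that the recursion can move along the word.
  chains : ℕ → ℕ → ℕ
  chains q i = ∑ (tuples P1423 n q) (λ t → χ (all f ((p1423 , i) ∷ t) ∧ chainOK n ((p1423 , i) ∷ t)))

  f-begins : ∀ i → f (p1423 , suc i) ≡ begins (drop i σ)
  f-begins i = trans (f-occursAt (suc i)) (occursAt-drop σ i)

  χ-∧ : ∀ a b c x y → χ ((a ∧ x) ∧ (b ∧ (c ∧ y))) ≡ (if a then (if b ∧ c then χ (x ∧ y) else 0) else 0)
  χ-∧ false b     c     x     y = refl
  χ-∧ true  true  true  x     y = refl
  χ-∧ true  true  false true  y = refl
  χ-∧ true  true  false false y = refl
  χ-∧ true  false c     true  y = refl
  χ-∧ true  false c     false y = refl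

  ∑-if : {A : Set} (b : Bool) (xs : List A) (g : A → ℕ) →
    ∑ xs (λ x → if b then g x else 0) ≡ (if b then ∑ xs g else 0)
  ∑-if true  xs g = refl
  ∑-if false xs g = ℕW.sumOver-0 xs (λ _ → refl)

  chains-suc : ∀ q i → chains (suc q) (suc i) ≡
    (if begins (drop i σ) then ∑ (upTo n) (λ j → if (i <ᵇ j) ∧ (j <ᵇ i ℕ.+ 4) then chains q (suc j) else 0) else 0)
  chains-suc q i = begin
    chains (suc q) (suc i)
      ≡⟨ ∑-tuples n q _ ⟩
    ∑ (range n) (λ j → ∑ (tuples P1423 n q) (λ t →
      χ ((f (p1423 , suc i) ∧ all f ((p1423 , j) ∷ t)) ∧
         ((suc i <ᵇ j) ∧ ((j <ᵇ suc i ℕ.+ 4) ∧ chainOK n ((p1423 , j) ∷ t))))))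
      ≡⟨ ℕW.sumOver-cong (range n) (λ {j} _ → trans
           (ℕW.sumOver-cong (tuples P1423 n q) (λ {t} _ → χ-∧ (f (p1423 , suc i)) (suc i <ᵇ j) (j <ᵇ suc i ℕ.+ 4) _ _))
           (trans (∑-if (f (p1423 , suc i)) (tuples P1423 n q) _)
             (cong (λ x → if f (p1423 , suc i) then x else 0)
               (∑-if ((suc i <ᵇ j) ∧ (j <ᵇ suc i ℕ.+ 4)) (tuples P1423 n q) _)))) ⟩
    ∑ (range n) (λ j → if f (p1423 , suc i)
                         then (if (suc i <ᵇ j) ∧ (j <ᵇ suc i ℕ.+ 4) then chains q j else 0) else 0)
      ≡⟨ ∑-if (f (p1423 , suc i)) (range n) _ ⟩
    (if f (p1423 , suc i) then ∑ (range n) (λ j → if (suc i <ᵇ j) ∧ (j <ᵇ suc i ℕ.+ 4) then chains q j else 0) else 0)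
      ≡⟨ cong₂ (λ b x → if b then x else 0) (f-begins i) (ℕW.sumOver-map suc (upTo n) _) ⟩
    (if begins (drop i σ) then ∑ (upTo n) (λ j → if (i <ᵇ j) ∧ (j <ᵇ i ℕ.+ 4) then chains q (suc j) else 0) else 0) ∎
    where open ≡-Reasoning

  chains-0 : ∀ i → chains 0 (suc i) ≡ (if begins (drop i σ) then χ (n ≡ᵇ i ℕ.+ 4) else 0)
  chains-0 i rewrite f-begins i with begins (drop i σ)
  ... | true  = ℕ.+-identityʳ _
  ... | false = refl

  chains≡clusters : ∀ q i → chains q (suc i) ≡ clusters (drop i σ) (suc q)
  chains≡clusters q i with drop i σ in eq
  chains≡clusters zero i | [] rewrite chains-0 i | eq = refl
  chains≡clusters zero i | _ ∷ [] rewrite chains-0 i | eq = refl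
  chains≡clusters zero i | _ ∷ _ ∷ [] rewrite chains-0 i | eq = refl
  chains≡clusters zero i | _ ∷ _ ∷ _ ∷ [] rewrite chains-0 i | eq = refl
  chains≡clusters zero i | a ∷ b ∷ c ∷ d ∷ ρ
    rewrite chains-0 i | eq | length-drop-∷ i σ eq | +-cancelˡ-≡ᵇ i (4 ℕ.+ length ρ) 4
    = cong (λ x → if inOrder a b c d then x else 0) (last ρ)
    where
    -- Of the three continuations only the single letter d can be a 0-cluster, and it is one exactly
    -- when the window ends at n.
    last : ∀ ρ → χ (length ρ ≡ᵇ 0) ≡ clusters (b ∷ c ∷ d ∷ ρ) 0 ℕ.+ (clusters (c ∷ d ∷ ρ) 0 ℕ.+ clusters (d ∷ ρ) 0)
    last []              = refl
    last (_ ∷ [])        = refl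
    last (_ ∷ _ ∷ [])    = refl
    last (_ ∷ _ ∷ _ ∷ _) = refl
  chains≡clusters (suc q) i | [] rewrite chains-suc q i | eq = refl
  chains≡clusters (suc q) i | _ ∷ [] rewrite chains-suc q i | eq = refl
  chains≡clusters (suc q) i | _ ∷ _ ∷ [] rewrite chains-suc q i | eq = refl
  chains≡clusters (suc q) i | _ ∷ _ ∷ _ ∷ [] rewrite chains-suc q i | eq = refl
  chains≡clusters (suc q) i | a ∷ b ∷ c ∷ d ∷ ρ rewrite chains-suc q i | eq =
    cong (λ x → if inOrder a b c d then x else 0) (trans
      (∑-window i n (chains q ∘ suc) i+4≤n)
      (cong₂ ℕ._+_ (at (suc i) eq₁) (cong₂ ℕ._+_ (at (2 ℕ.+ i) eq₂) (at (3 ℕ.+ i) eq₃))))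
    where
    i+4≤n : i ℕ.+ 4 ≤ n
    i+4≤n = subst (i ℕ.+ 4 ≤_) (sym (length-drop-∷ i σ eq)) (ℕ.+-monoʳ-≤ i (s≤s (s≤s (s≤s (s≤s z≤n)))))
    eq₁ : drop (1 ℕ.+ i) σ ≡ b ∷ c ∷ d ∷ ρ
    eq₁ = drop-suc i σ eq
    eq₂ : drop (2 ℕ.+ i) σ ≡ c ∷ d ∷ ρ
    eq₂ = drop-suc (suc i) σ eq₁
    eq₃ : drop (3 ℕ.+ i) σ ≡ d ∷ ρ
    eq₃ = drop-suc (2 ℕ.+ i) σ eq₂
    at : ∀ j {ρ′} → drop j σ ≡ ρ′ → chains q (suc j) ≡ clusters ρ′ (suc q)
    at j e = trans (chains≡clusters q j) (cong (λ l → clusters l (suc q)) e)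

  clusters-tuples : 1 ≤ n → ∀ q →
    ∑ (range n) (λ i → ∑ (tuples P1423 n q) (λ t →
      χ ((i ≡ᵇ 1) ∧ (all f ((p1423 , i) ∷ t) ∧ chainOK n ((p1423 , i) ∷ t))))) ≡ clusters σ (suc q)
  clusters-tuples 1≤n q = begin
    ∑ (range n) start                        ≡⟨ ℕW.sumOver-map suc (upTo n) start ⟩
    ∑ (upTo n) (start ∘ suc)                 ≡⟨ first n 1≤n ⟩
    chains q 1                               ≡⟨ chains≡clusters q 0 ⟩
    clusters σ (suc q)                       ∎
    where
    open ≡-Reasoning
    start : ℕ → ℕ
    start i = ∑ (tuples P1423 n q) (λ t → χ ((i ≡ᵇ 1) ∧ (all f ((p1423 , i) ∷ t) ∧ chainOK n ((p1423 , i) ∷ t))))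
    first : ∀ m → 1 ≤ m → ∑ (upTo m) (start ∘ suc) ≡ chains q 1
    first (suc m) _ = begin
      ∑ (upTo (suc m)) (start ∘ suc)
        ≡⟨ ℕW.sumOver-upTo-suc m (start ∘ suc) ⟩
      chains q 1 ℕ.+ ∑ (upTo m) (λ i → start (2 ℕ.+ i))
        ≡⟨ cong (chains q 1 ℕ.+_) (ℕW.sumOver-0 (upTo m) (λ _ → ℕW.sumOver-0 (tuples P1423 n q) (λ _ → refl))) ⟩
      chains q 1 ℕ.+ 0
        ≡⟨ ℕ.+-identityʳ (chains q 1) ⟩
      chains q 1 ∎

-- The length bound excludes the one-letter word, which has a 0-cluster for `clusters` but none for
-- `isCluster`.
isCluster-count : (σ : List ℕ) → 2 ≤ length σ → ∀ q →
  length (filter (λ t → isCluster P1423 (length σ) σ t Bool.≟ true) (tuples P1423 (length σ) q)) ≡ clusters σ q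
isCluster-count σ@(_ ∷ [])                (s≤s ()) q
isCluster-count σ@(_ ∷ _ ∷ [])            _ zero = refl
isCluster-count σ@(_ ∷ _ ∷ _ ∷ [])        _ zero = refl
isCluster-count σ@(_ ∷ _ ∷ _ ∷ _ ∷ _)     _ zero = refl
isCluster-count σ                         2≤ (suc q) =
  trans (length-filter (isCluster P1423 (length σ) σ) (tuples P1423 (length σ) (suc q)))
    (trans (∑-tuples (length σ) q (χ ∘ isCluster P1423 (length σ) σ))
      -- The `_` stands for the anonymous test in `isCluster`, found by unification. On `p1423` the
      -- membership test in `P1423` computes to true, so `refl` suffices.
      (CountTuples.clusters-tuples σ _ (λ i → refl) (ℕ.<⇒≤ 2≤) q))

numClusters-count : (n q : ℕ) → 2 ≤ n → numClusters P1423 n q ≡ count (range n) (λ σ → clusters σ q)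
numClusters-count n q 2≤n = trans (ℕW.sumOver-↭ _ (perms-↭ n)) (ℕW.total-cong (range n) per)
  where
  per : ∀ {σ} → σ ↭ range n →
    length (filter (λ t → isCluster P1423 n σ t Bool.≟ true) (tuples P1423 n q)) ≡ clusters σ q
  per {σ} p with trans (↭-length p) (range-length n)
  ... | refl = isCluster-count σ 2≤n q

-- The exponential generating function

occ : List ℕ → ℕ
occ []      = 0
occ (x ∷ σ) = χ (begins (x ∷ σ)) ℕ.+ occ σ

occurrences-occ : ∀ σ → occurrences (length σ) σ p1423 ≡ occ σ
occurrences-occ σ = begin
  occurrences (length σ) σ p1423
    ≡⟨ length-filter (occursAt (length σ) σ p1423) (range (length σ)) ⟩
  ∑ (range (length σ)) (χ ∘ occursAt (length σ) σ p1423)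
    ≡⟨ ℕW.sumOver-map suc (upTo (length σ)) _ ⟩
  ∑ (upTo (length σ)) (χ ∘ occursAt (length σ) σ p1423 ∘ suc)
    ≡⟨ ℕW.sumOver-cong (upTo (length σ)) (λ {i} _ → cong χ (occursAt-drop σ i)) ⟩
  ∑ (upTo (length σ)) (λ i → χ (begins (drop i σ)))
    ≡⟨ suffixes σ ⟩
  occ σ ∎
  where
  open ≡-Reasoning
  suffixes : ∀ σ → ∑ (upTo (length σ)) (λ i → χ (begins (drop i σ))) ≡ occ σ
  suffixes []      = refl
  suffixes (x ∷ σ) = trans (ℕW.sumOver-upTo-suc (length σ) (λ i → χ (begins (drop i (x ∷ σ)))))
    (cong (χ (begins (x ∷ σ)) ℕ.+_) (suffixes σ))

occ-≤ : ∀ σ → occ σ ≤ length σ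
occ-≤ []      = z≤n
occ-≤ (x ∷ σ) = ℕ.+-mono-≤ (χ≤1 (begins (x ∷ σ))) (occ-≤ σ)
  where
  χ≤1 : ∀ b → χ b ≤ 1
  χ≤1 true  = s≤s z≤n
  χ≤1 false = z≤n

occ-sameOrder : ∀ zs → SameOrder zs → occ (map proj₁ zs) ≡ occ (map proj₂ zs)
occ-sameOrder []       h = refl
occ-sameOrder (z ∷ zs) h =
  cong₂ (λ b n → χ b ℕ.+ n) (begins-sameOrder (z ∷ zs) h) (occ-sameOrder zs (sameOrder-tail h))

module GeneratingFunction {a ℓ : Level} (R : CommutativeRing a ℓ) (t : CommutativeRing.Carrier R) where

  open CommutativeRing R hiding (zero) renaming (refl to ≈-refl; sym to ≈-sym; trans to ≈-trans)
  open EGF R t hiding (Σ)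
  open Weighted commutativeSemiring
  open import Relation.Binary.Reasoning.Setoid setoid
  open import Algebra.Properties.Ring ring using (-1*x≈-x)
  open import Algebra.Solver.Ring.NaturalCoefficients.Default commutativeSemiring

  ι-+ : ∀ m n → ι (m ℕ.+ n) ≈ ι m + ι n
  ι-+ zero    n = ≈-sym (+-identityˡ _)
  ι-+ (suc m) n = ≈-trans (+-congˡ (ι-+ m n)) (≈-sym (+-assoc _ _ _))

  ι-∑ : {A : Set} (xs : List A) (f : A → ℕ) → ι (∑ xs f) ≈ sumOver xs (ι ∘ f)
  ι-∑ []       f = ≈-refl
  ι-∑ (x ∷ xs) f = ≈-trans (ι-+ (f x) (∑ xs f)) (+-congˡ (ι-∑ xs f))

  ι-*-cong : ∀ {m n} → m ≡ n → (x : Carrier) → ι m * x ≈ ι n * x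
  ι-*-cong eq x = *-congʳ (reflexive (cong ι eq))

  sumOver-*ʳ : {A : Set} (xs : List A) (f : A → Carrier) (k : Carrier) → sumOver xs f * k ≈ sumOver xs (λ x → f x * k)
  sumOver-*ʳ xs f k = begin
    sumOver xs f * k              ≈⟨ *-comm _ _ ⟩
    k * sumOver xs f              ≈⟨ sumOver-*ˡ xs k f ⟨
    sumOver xs (λ x → k * f x)    ≈⟨ sumOver-cong xs (λ _ → *-comm _ _) ⟩
    sumOver xs (λ x → f x * k)    ∎

  sumOver-upTo-last : ∀ n (f : ℕ → Carrier) → sumOver (upTo (suc n)) f ≈ sumOver (upTo n) f + f n
  sumOver-upTo-last n f = begin
    sumOver (upTo (suc n)) f                  ≡⟨ cong (λ l → sumOver l f) (List.upTo-∷ʳ n) ⟨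
    sumOver (upTo n ++ n ∷ []) f         ≈⟨ sumOver-++ (upTo n) (n ∷ []) f ⟩
    sumOver (upTo n) f + (f n + 0#)           ≈⟨ +-congˡ (+-identityʳ _) ⟩
    sumOver (upTo n) f + f n                  ∎

  binom-sum : ∀ (f g : ℕ → Carrier) n →
    binom f g n ≈ sumOver (upTo (suc n)) (λ m → ι (n C m) * (f m * g (n ∸ m)))
  binom-sum f g zero = solve 2 (λ x y → x :* y := (con 1 :+ con 0) :* (x :* y) :+ con 0) ≈-refl (f 0) (g 0)
  binom-sum f g (suc n) = begin
    binom (f ∘ suc) g n + binom f (g ∘ suc) n
      ≈⟨ +-cong (binom-sum (f ∘ suc) g n) (binom-sum f (g ∘ suc) n) ⟩
    A + sumOver (upTo (suc n)) (λ m → ι (n C m) * (f m * g (suc (n ∸ m))))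
      ≡⟨ cong (A +_) (sumOver-upTo-suc n _) ⟩
    A + (z + sumOver (upTo n) (λ m → ι (n C suc m) * (f (suc m) * g (suc (n ∸ suc m)))))
      -- Subtraction is truncated: suc (n ∸ suc m) equals n ∸ m only for m < n. The term m = n is
      -- added afterwards, where its binomial coefficient is 0.
      ≈⟨ +-congˡ (+-congˡ (sumOver-cong (upTo n) λ {m} m∈ →
           reflexive (cong (λ i → ι (n C suc m) * (f (suc m) * g i)) (sym (ℕ.+-∸-assoc 1 (∈-upTo⁻ m∈)))))) ⟩
    A + (z + sumOver (upTo n) h)
      ≈⟨ +-congˡ (+-congˡ (+-identityʳ _)) ⟨
    A + (z + (sumOver (upTo n) h + 0#))
      ≈⟨ +-congˡ (+-congˡ (+-congˡ h-n)) ⟨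
    A + (z + (sumOver (upTo n) h + h n))
      ≈⟨ +-congˡ (+-congˡ (sumOver-upTo-last n h)) ⟨
    A + (z + sumOver (upTo (suc n)) h)
      ≈⟨ solve 3 (λ x y w → x :+ (y :+ w) := y :+ (x :+ w)) ≈-refl _ _ _ ⟩
    z + (A + sumOver (upTo (suc n)) h)
      ≈⟨ +-congˡ (sumOver-+ (upTo (suc n)) _ h) ⟨
    z + sumOver (upTo (suc n)) (λ m → ι (n C m) * (f (suc m) * g (n ∸ m)) + h m)
      ≈⟨ +-congˡ (sumOver-cong (upTo (suc n)) λ {m} _ → pascal m) ⟩
    z + sumOver (upTo (suc n)) (λ m → ι (suc n C suc m) * (f (suc m) * g (n ∸ m)))
      ≡⟨ sumOver-upTo-suc (suc n) _ ⟨
    sumOver (upTo (suc (suc n))) (λ m → ι (suc n C m) * (f m * g (suc n ∸ m))) ∎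
    where
    A z : Carrier
    A = sumOver (upTo (suc n)) (λ m → ι (n C m) * (f (suc m) * g (n ∸ m)))
    z = ι (suc n C 0) * (f 0 * g (suc n))
    h : ℕ → Carrier
    h m = ι (n C suc m) * (f (suc m) * g (n ∸ m))
    h-n : h n ≈ 0#
    h-n = ≈-trans (ι-*-cong (k>n⇒nCk≡0 (ℕ.n<1+n n)) _) (zeroˡ _)
    pascal : ∀ m → ι (n C m) * (f (suc m) * g (n ∸ m)) + h m ≈ ι (suc n C suc m) * (f (suc m) * g (n ∸ m))
    pascal m = begin
      ι (n C m) * (f (suc m) * g (n ∸ m)) + h m             ≈⟨ distribʳ _ _ _ ⟨
      (ι (n C m) + ι (n C suc m)) * (f (suc m) * g (n ∸ m)) ≈⟨ *-congʳ (ι-+ (n C m) (n C suc m)) ⟨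
      ι (n C m ℕ.+ n C suc m) * (f (suc m) * g (n ∸ m))     ≈⟨ ι-*-cong (nCk+nC[k+1]≡[n+1]C[k+1] n m) _ ⟩
      ι (suc n C suc m) * (f (suc m) * g (n ∸ m))           ∎

  binom-cong : ∀ {f f′ g g′ : ℕ → Carrier} → (∀ n → f n ≈ f′ n) → (∀ n → g n ≈ g′ n) →
    ∀ n → binom f g n ≈ binom f′ g′ n
  binom-cong hf hg zero    = *-cong (hf 0) (hg 0)
  binom-cong hf hg (suc n) = +-cong (binom-cong (hf ∘ suc) hg n) (binom-cong hf (hg ∘ suc) n)

  sumOver-indicator : ∀ {m N} (g : ℕ → Carrier) → m < N → sumOver (upTo N) (λ k → ι (χ (m ≡ᵇ k)) * g k) ≈ g m
  sumOver-indicator {zero} {suc N} g _ = begin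
    sumOver (upTo (suc N)) (λ k → ι (χ (0 ≡ᵇ k)) * g k)
      ≡⟨ sumOver-upTo-suc N _ ⟩
    (1# + 0#) * g 0 + sumOver (upTo N) (λ k → 0# * g (suc k))
      ≈⟨ +-congˡ (sumOver-0 (upTo N) (λ _ → zeroˡ _)) ⟩
    (1# + 0#) * g 0 + 0#
      ≈⟨ solve 1 (λ x → (con 1 :+ con 0) :* x :+ con 0 := x) ≈-refl _ ⟩
    g 0 ∎
  sumOver-indicator {suc m} {suc N} g (s≤s m<N) = begin
    sumOver (upTo (suc N)) (λ k → ι (χ (suc m ≡ᵇ k)) * g k)
      ≡⟨ sumOver-upTo-suc N _ ⟩
    0# * g 0 + sumOver (upTo N) (λ k → ι (χ (m ≡ᵇ k)) * g (suc k))
      ≈⟨ +-cong (zeroˡ _) (sumOver-indicator (g ∘ suc) m<N) ⟩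
    0# + g (suc m)
      ≈⟨ +-identityˡ _ ⟩
    g (suc m) ∎

  -- Turns the refined numbers `piNK` into one sum of t to the number of occurrences; the bound N
  -- ensures that no fibre is lost.
  sumOver-fibres : {A : Set} (xs : List A) (h : A → ℕ) (g : ℕ → Carrier) (N : ℕ) → (∀ {x} → x ∈ xs → h x < N) →
    sumOver (upTo N) (λ k → ι (length (filter (λ x → h x ℕ.≟ k) xs)) * g k) ≈ sumOver xs (g ∘ h)
  sumOver-fibres xs h g N h<N = begin
    sumOver (upTo N) (λ k → ι (length (filter (λ x → h x ℕ.≟ k) xs)) * g k)
      ≈⟨ sumOver-cong (upTo N) (λ {k} _ → ≈-trans (ι-*-cong (fibre k xs) (g k)) (*-congʳ (ι-∑ xs _))) ⟩
    sumOver (upTo N) (λ k → sumOver xs (λ x → ι (χ (h x ≡ᵇ k))) * g k)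
      ≈⟨ sumOver-cong (upTo N) (λ {k} _ → sumOver-*ʳ xs _ (g k)) ⟩
    sumOver (upTo N) (λ k → sumOver xs (λ x → ι (χ (h x ≡ᵇ k)) * g k))
      ≈⟨ sumOver-swap (upTo N) xs _ ⟩
    sumOver xs (λ x → sumOver (upTo N) (λ k → ι (χ (h x ≡ᵇ k)) * g k))
      ≈⟨ sumOver-cong xs (λ x∈ → sumOver-indicator g (h<N x∈)) ⟩
    sumOver xs (g ∘ h) ∎
    where
    fibre : ∀ k xs → length (filter (λ x → h x ℕ.≟ k) xs) ≡ ∑ xs (λ x → χ (h x ≡ᵇ k))
    fibre k []       = refl
    fibre k (x ∷ xs) with h x ≡ᵇ k
    ... | true  = cong suc (fibre k xs)
    ... | false = fibre k xs

  u : Carrier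
  u = t - 1#

  weight : List ℕ → Carrier
  weight σ = pow t (occ σ)

  Pi-total : ∀ n → Pi n ≈ total (range n) weight
  Pi-total n = begin
    Pi n
      ≈⟨ sumOver-fibres (perms n) (λ σ → occurrences n σ p1423) (pow t) (suc n) bound ⟩
    sumOver (perms n) (λ σ → pow t (occurrences n σ p1423))
      ≈⟨ sumOver-↭ _ (perms-↭ n) ⟩
    total (range n) (λ σ → pow t (occurrences n σ p1423))
      ≈⟨ total-cong (range n) (λ p → reflexive (cong (pow t) (occ-at (trans (↭-length p) (range-length n))))) ⟩
    total (range n) weight ∎
    where
    occ-at : ∀ {σ} → length σ ≡ n → occurrences n σ p1423 ≡ occ σ
    occ-at {σ} refl = occurrences-occ σ
    bound : ∀ {σ} → σ ∈ perms n → occurrences n σ p1423 < suc n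
    bound {σ} σ∈ with trans (↭-length (∈-arrangements⇒↭ (range n) (∈-resp-↭ (perms-↭ n) σ∈))) (range-length n)
    ... | len rewrite occ-at {σ} len = s≤s (subst (occ σ ≤_) len (occ-≤ σ))

  -- The generating polynomial in u of the clusters carried by one fixed word. A single letter has
  -- weight 1, so an unmarked entry can be cut off the front just like a cluster.
  clusterWeight : List ℕ → Carrier
  clusterWeight []                  = 0#
  clusterWeight (a ∷ [])            = 1#
  clusterWeight (a ∷ b ∷ [])        = 0#
  clusterWeight (a ∷ b ∷ c ∷ [])    = 0#
  clusterWeight (a ∷ b ∷ c ∷ d ∷ σ) = if inOrder a b c d
    then u * (clusterWeight (b ∷ c ∷ d ∷ σ) + (clusterWeight (c ∷ d ∷ σ) + clusterWeight (d ∷ σ)))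
    else 0#

  -- Every further occurrence leaves a word shorter by at least one letter, so N can drop by one at
  -- each step of the recursion.
  clusterWeight-sum : ∀ N σ → length σ ≤ N →
    sumOver (upTo N) (λ l → ι (clusters σ l) * pow u l) ≈ clusterWeight σ
  clusterWeight-sum N []               _ = sumOver-0 (upTo N) (λ _ → zeroˡ _)
  clusterWeight-sum N (_ ∷ _ ∷ [])     _ = sumOver-0 (upTo N) (λ _ → zeroˡ _)
  clusterWeight-sum N (_ ∷ _ ∷ _ ∷ []) _ = sumOver-0 (upTo N) (λ _ → zeroˡ _)
  clusterWeight-sum (suc N) (a ∷ []) _ = begin
    sumOver (upTo (suc N)) (λ l → ι (clusters (a ∷ []) l) * pow u l)
      ≡⟨ sumOver-upTo-suc N _ ⟩
    (1# + 0#) * 1# + sumOver (upTo N) (λ l → 0# * pow u (suc l))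
      ≈⟨ +-congˡ (sumOver-0 (upTo N) (λ _ → zeroˡ _)) ⟩
    (1# + 0#) * 1# + 0#
      ≈⟨ solve 0 ((con 1 :+ con 0) :* con 1 :+ con 0 := con 1) ≈-refl ⟩
    1# ∎
  clusterWeight-sum (suc N) (a ∷ b ∷ c ∷ d ∷ σ) (s≤s len) = begin
    sumOver (upTo (suc N)) (λ l → ι (clusters (a ∷ b ∷ c ∷ d ∷ σ) l) * pow u l)
      ≡⟨ sumOver-upTo-suc N _ ⟩
    0# * 1# + sumOver (upTo N) (λ l → ι (if inOrder a b c d then later l else 0) * (u * pow u l))
      ≈⟨ ≈-trans (+-congʳ (zeroˡ _)) (+-identityˡ _) ⟩
    sumOver (upTo N) (λ l → ι (if inOrder a b c d then later l else 0) * (u * pow u l))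
      ≈⟨ step (inOrder a b c d) ⟩
    clusterWeight (a ∷ b ∷ c ∷ d ∷ σ) ∎
    where
    later : ℕ → ℕ
    later l = clusters (b ∷ c ∷ d ∷ σ) l ℕ.+ (clusters (c ∷ d ∷ σ) l ℕ.+ clusters (d ∷ σ) l)
    term : List ℕ → ℕ → Carrier
    term τ l = ι (clusters τ l) * pow u l
    distribute : ∀ l → ι (later l) * (u * pow u l) ≈ u * (term (b ∷ c ∷ d ∷ σ) l + (term (c ∷ d ∷ σ) l + term (d ∷ σ) l))
    distribute l = ≈-trans (*-congʳ (≈-trans (ι-+ (clusters (b ∷ c ∷ d ∷ σ) l) _) (+-congˡ (ι-+ (clusters (c ∷ d ∷ σ) l) _))))
      (solve 5 (λ x y z w p → (x :+ (y :+ z)) :* (w :* p) := w :* (x :* p :+ (y :* p :+ z :* p))) ≈-refl _ _ _ _ _)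
    step : ∀ o → sumOver (upTo N) (λ l → ι (if o then later l else 0) * (u * pow u l)) ≈
      (if o then u * (clusterWeight (b ∷ c ∷ d ∷ σ) + (clusterWeight (c ∷ d ∷ σ) + clusterWeight (d ∷ σ))) else 0#)
    step false = sumOver-0 (upTo N) (λ _ → zeroˡ _)
    step true  = begin
      sumOver (upTo N) (λ l → ι (later l) * (u * pow u l))
        ≈⟨ sumOver-cong (upTo N) (λ {l} _ → distribute l) ⟩
      sumOver (upTo N) (λ l → u * (term (b ∷ c ∷ d ∷ σ) l + (term (c ∷ d ∷ σ) l + term (d ∷ σ) l)))
        ≈⟨ sumOver-*ˡ (upTo N) u _ ⟩
      u * sumOver (upTo N) (λ l → term (b ∷ c ∷ d ∷ σ) l + (term (c ∷ d ∷ σ) l + term (d ∷ σ) l))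
        ≈⟨ *-congˡ (≈-trans (sumOver-+ (upTo N) _ _) (+-congˡ (sumOver-+ (upTo N) _ _))) ⟩
      u * (sumOver (upTo N) (term (b ∷ c ∷ d ∷ σ)) + (sumOver (upTo N) (term (c ∷ d ∷ σ)) + sumOver (upTo N) (term (d ∷ σ))))
        ≈⟨ *-congˡ (+-cong (clusterWeight-sum N (b ∷ c ∷ d ∷ σ) len)
             (+-cong (clusterWeight-sum N (c ∷ d ∷ σ) (ℕ.<⇒≤ len))
                     (clusterWeight-sum N (d ∷ σ) (ℕ.<⇒≤ (ℕ.<⇒≤ len))))) ⟩
      u * (clusterWeight (b ∷ c ∷ d ∷ σ) + (clusterWeight (c ∷ d ∷ σ) + clusterWeight (d ∷ σ))) ∎

  -- The contribution of a single word to D; the one-letter word accounts for the term -x.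
  denominator : List ℕ → Carrier
  denominator []      = 1#
  denominator (x ∷ σ) = - 1# * clusterWeight (x ∷ σ)

  D-total : ∀ n → D n ≈ total (range n) denominator
  D-total zero          = ≈-sym (+-identityʳ 1#)
  D-total (suc zero)    = ≈-sym (≈-trans (+-identityʳ _) (*-identityʳ _))
  D-total n@(suc (suc m)) = begin
    - sumOver (range n) (λ l → ι (c n (ℤ.+ l)) * pow u l)
      ≈⟨ -1*x≈-x _ ⟨
    - 1# * sumOver (range n) (λ l → ι (c n (ℤ.+ l)) * pow u l)
      ≈⟨ *-congˡ (sumOver-cong (range n) (λ {l} _ → ≈-trans
           (ι-*-cong (numClusters-count n l (s≤s (s≤s z≤n))) (pow u l))
           (≈-trans (*-congʳ (ι-∑ perm _)) (sumOver-*ʳ perm _ _)))) ⟩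
    - 1# * sumOver (range n) (λ l → total (range n) (λ σ → ι (clusters σ l) * pow u l))
      ≈⟨ *-congˡ (sumOver-swap (range n) perm _) ⟩
    - 1# * total (range n) (λ σ → sumOver (range n) (λ l → ι (clusters σ l) * pow u l))
      ≈⟨ sumOver-*ˡ perm (- 1#) _ ⟨
    total (range n) (λ σ → - 1# * sumOver (range n) (λ l → ι (clusters σ l) * pow u l))
      ≈⟨ total-cong (range n) (λ {σ} p → per σ (trans (↭-length p) (range-length n))) ⟩
    total (range n) denominator ∎
    where
    perm : List (List ℕ)
    perm = arrangements (range n)
    no-0-cluster : ∀ x y σ → clusters (x ∷ y ∷ σ) 0 ≡ 0
    no-0-cluster x y []          = refl
    no-0-cluster x y (_ ∷ [])    = refl
    no-0-cluster x y (_ ∷ _ ∷ _) = refl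
    per : ∀ σ → length σ ≡ n → - 1# * sumOver (range n) (λ l → ι (clusters σ l) * pow u l) ≈ denominator σ
    per (_ ∷ [])        ()
    per σ@(x ∷ y ∷ τ) len = *-congˡ (begin
      sumOver (range n) (λ l → ι (clusters σ l) * pow u l)
        ≡⟨ sumOver-map suc (upTo n) _ ⟩
      sumOver (upTo n) (λ l → ι (clusters σ (suc l)) * pow u (suc l))
        ≈⟨ +-identityˡ _ ⟨
      0# + sumOver (upTo n) (λ l → ι (clusters σ (suc l)) * pow u (suc l))
        -- Adding the vanishing term l = 0 turns the range 1, ..., n of `D` into the initial segment
        -- that `clusterWeight-sum` sums over.
        ≈⟨ +-congʳ (≈-trans (ι-*-cong (no-0-cluster x y τ) _) (zeroˡ _)) ⟨
      ι (clusters σ 0) * 1# + sumOver (upTo n) (λ l → ι (clusters σ (suc l)) * pow u (suc l))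
        ≡⟨ sumOver-upTo-suc n (λ l → ι (clusters σ l) * pow u l) ⟨
      sumOver (upTo (suc n)) (λ l → ι (clusters σ l) * pow u l)
        ≈⟨ clusterWeight-sum (suc n) σ (subst (_≤ suc n) (sym len) (ℕ.n≤1+n n)) ⟩
      clusterWeight σ ∎)

  weight-orderInvariant : OrderInvariant weight
  weight-orderInvariant zs h = reflexive (cong (pow t) (occ-sameOrder zs h))

  clusterWeight-orderInvariant : OrderInvariant clusterWeight
  clusterWeight-orderInvariant zs h = begin
    clusterWeight (map proj₁ zs)
      ≈⟨ clusterWeight-sum (length zs) (map proj₁ zs) (ℕ.≤-reflexive (List.length-map proj₁ zs)) ⟨
    sumOver (upTo (length zs)) (λ l → ι (clusters (map proj₁ zs) l) * pow u l)
      ≈⟨ sumOver-cong (upTo (length zs)) (λ {l} _ → ι-*-cong (clusters-orderInvariant l zs h) (pow u l)) ⟩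
    sumOver (upTo (length zs)) (λ l → ι (clusters (map proj₂ zs) l) * pow u l)
      ≈⟨ clusterWeight-sum (length zs) (map proj₂ zs) (ℕ.≤-reflexive (List.length-map proj₂ zs)) ⟩
    clusterWeight (map proj₂ zs) ∎

  denominator-orderInvariant : OrderInvariant denominator
  denominator-orderInvariant []       h = ≈-refl
  denominator-orderInvariant (z ∷ zs) h = *-congˡ (clusterWeight-orderInvariant (z ∷ zs) h)

  x+ux≈tx : ∀ x → x + u * x ≈ t * x
  x+ux≈tx x = begin
    x + u * x              ≈⟨ solve 3 (λ x t m → x :+ (t :+ m) :* x := t :* x :+ (con 1 :+ m) :* x) ≈-refl x t (- 1#) ⟩
    t * x + (1# + - 1#) * x ≈⟨ +-congˡ (≈-trans (*-congʳ (-‿inverseʳ 1#)) (zeroˡ x)) ⟩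
    t * x + 0#             ≈⟨ +-identityʳ _ ⟩
    t * x                  ∎

  -- If the front window is unmarked, a is cut off and w₃ remains. If it is a marked occurrence, the
  -- factor u multiplies the sum over the three continuations at b, c, d, which by induction is
  -- again w₃. The total is (1 + u) w₃ = t w₃.
  conv-clusters-step : ∀ a b c d σ →
    conv clusterWeight weight (b ∷ c ∷ d ∷ σ) ≈ weight (b ∷ c ∷ d ∷ σ) →
    conv clusterWeight weight (c ∷ d ∷ σ) ≈ weight (c ∷ d ∷ σ) →
    conv clusterWeight weight (d ∷ σ) ≈ weight (d ∷ σ) →
    conv clusterWeight weight (a ∷ b ∷ c ∷ d ∷ σ) ≈ weight (a ∷ b ∷ c ∷ d ∷ σ)
  conv-clusters-step a b c d σ ih₃ ih₂ ih₁ = begin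
    0# * weight (a ∷ b ∷ c ∷ d ∷ σ) + (1# * w₃ + (0# * w₂ + (0# * w₁ + rest)))
      ≈⟨ solve 5 (λ v x y z r → con 0 :* v :+ (con 1 :* x :+ (con 0 :* y :+ (con 0 :* z :+ r))) := x :+ r) ≈-refl _ _ _ _ _ ⟩
    w₃ + rest
      ≈⟨ step (inOrder a b c d) ⟩
    weight (a ∷ b ∷ c ∷ d ∷ σ) ∎
    where
    w₁ w₂ w₃ x₁ x₂ x₃ rest : Carrier
    w₁ = weight (d ∷ σ)
    w₂ = weight (c ∷ d ∷ σ)
    w₃ = weight (b ∷ c ∷ d ∷ σ)
    x₁ = conv (λ τ → clusterWeight (d ∷ τ)) weight σ
    x₂ = conv (λ τ → clusterWeight (c ∷ d ∷ τ)) weight σ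
    x₃ = conv (λ τ → clusterWeight (b ∷ c ∷ d ∷ τ)) weight σ
    rest = conv (λ τ → clusterWeight (a ∷ b ∷ c ∷ d ∷ τ)) weight σ
    -- Expanded, the induction hypotheses read x₁ = w₁, x₂ + w₁ = w₂ and x₃ + w₂ = w₃.
    telescope : x₃ + (x₂ + x₁) ≈ w₃
    telescope = begin
      x₃ + (x₂ + x₁)
        ≈⟨ +-congˡ (+-congˡ (≈-trans (≈-sym (≈-trans (+-congʳ (zeroˡ _)) (+-identityˡ _))) ih₁)) ⟩
      x₃ + (x₂ + w₁)
        ≈⟨ +-congˡ (solve 3 (λ x w v → x :+ w := con 0 :* v :+ (con 1 :* w :+ x)) ≈-refl x₂ w₁ w₂) ⟩
      x₃ + conv clusterWeight weight (c ∷ d ∷ σ)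
        ≈⟨ +-congˡ ih₂ ⟩
      x₃ + w₂
        ≈⟨ solve 4 (λ x w v y → x :+ w := con 0 :* v :+ (con 1 :* w :+ (con 0 :* y :+ x))) ≈-refl x₃ w₂ w₃ w₁ ⟩
      conv clusterWeight weight (b ∷ c ∷ d ∷ σ)
        ≈⟨ ih₃ ⟩
      w₃ ∎
    step : ∀ o → w₃ + conv (λ τ → if o
        then u * (clusterWeight (b ∷ c ∷ d ∷ τ) + (clusterWeight (c ∷ d ∷ τ) + clusterWeight (d ∷ τ))) else 0#) weight σ
      ≈ pow t (χ o ℕ.+ occ (b ∷ c ∷ d ∷ σ))
    step false = ≈-trans (+-congˡ (conv-0ˡ weight (λ _ → ≈-refl) σ)) (+-identityʳ _)
    step true  = begin
      w₃ + conv (λ τ → u * (clusterWeight (b ∷ c ∷ d ∷ τ) + (clusterWeight (c ∷ d ∷ τ) + clusterWeight (d ∷ τ)))) weight σ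
        ≈⟨ +-congˡ (≈-trans (conv-*ˡ u _ weight σ) (*-congˡ
             (≈-trans (conv-+ˡ _ _ weight σ) (+-congˡ (conv-+ˡ _ _ weight σ))))) ⟩
      w₃ + u * (x₃ + (x₂ + x₁))
        ≈⟨ +-congˡ (*-congˡ telescope) ⟩
      w₃ + u * w₃
        ≈⟨ x+ux≈tx w₃ ⟩
      t * w₃ ∎

  conv-clusters : ∀ x σ → conv clusterWeight weight (x ∷ σ) ≈ weight (x ∷ σ)
  conv-clusters a [] = solve 0 (con 0 :* con 1 :+ con 1 :* con 1 := con 1) ≈-refl
  conv-clusters a (b ∷ []) = solve 0 (con 0 :* con 1 :+ (con 1 :* con 1 :+ con 0 :* con 1) := con 1) ≈-refl
  conv-clusters a (b ∷ c ∷ []) =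
    solve 0 (con 0 :* con 1 :+ (con 1 :* con 1 :+ (con 0 :* con 1 :+ con 0 :* con 1)) := con 1) ≈-refl
  conv-clusters a (b ∷ c ∷ d ∷ σ) =
    conv-clusters-step a b c d σ (conv-clusters b (c ∷ d ∷ σ)) (conv-clusters c (d ∷ σ)) (conv-clusters d σ)

  conv-denominator : ∀ x σ → conv denominator weight (x ∷ σ) ≈ 0#
  conv-denominator x σ = begin
    1# * w + conv (λ τ → - 1# * clusterWeight (x ∷ τ)) weight σ
      ≈⟨ +-cong (*-identityˡ w) (conv-*ˡ (- 1#) (clusterWeight ∘ (x ∷_)) weight σ) ⟩
    w + - 1# * conv (clusterWeight ∘ (x ∷_)) weight σ
      ≈⟨ +-congˡ (*-congˡ (≈-trans (≈-sym (≈-trans (+-congʳ (zeroˡ _)) (+-identityˡ _))) (conv-clusters x σ))) ⟩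
    w + - 1# * w
      ≈⟨ +-congˡ (-1*x≈-x w) ⟩
    w + - w
      ≈⟨ -‿inverseʳ w ⟩
    0# ∎
    where
    w : Carrier
    w = weight (x ∷ σ)

  total-conv-denominator : ∀ n → total (range n) (conv denominator weight) ≈ one n
  total-conv-denominator zero    = solve 0 (con 1 :* con 1 :+ con 0 := con 1) ≈-refl
  total-conv-denominator (suc n) = ≈-trans
    (total-cong (range (suc n)) {G = λ _ → 0#} (λ {σ} p → per σ (trans (↭-length p) (range-length (suc n)))))
    (sumOver-0 (arrangements (range (suc n))) (λ _ → ≈-refl))
    where
    per : ∀ σ → length σ ≡ suc n → conv denominator weight σ ≈ 0#
    per (x ∷ σ) _ = conv-denominator x σ

  prodCoeff≈one : ∀ n → prodCoeff n ≈ one n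
  prodCoeff≈one n = begin
    prodCoeff n
      ≈⟨ binom-sum Pi D n ⟨
    binom Pi D n
      -- `prodCoeff` has the factor Π first, but clusters are cut off at the front of the word, so D
      -- has to govern the prefix.
      ≈⟨ binom-comm Pi D n ⟩
    binom D Pi n
      ≈⟨ binom-cong D-total Pi-total n ⟩
    binom (λ m → total (range m) denominator) (λ m → total (range m) weight) n
      ≡⟨ cong (binom (λ m → total (range m) denominator) (λ m → total (range m) weight)) (range-length n) ⟨
    binom (λ m → total (range m) denominator) (λ m → total (range m) weight) (length (range n))
      ≈⟨ splits-length (range n) (by-length denominator-orderInvariant) (by-length weight-orderInvariant) ⟨
    splits (λ A → total A denominator) (λ B → total B weight) (range n)
      ≈⟨ total-conv denominator weight (range n) ⟨
    total (range n) (conv denominator weight)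
      ≈⟨ total-conv-denominator n ⟩
    one n ∎
    where
    by-length : ∀ {F} → OrderInvariant F → ∀ {M} → M ⊆ range n → total M F ≈ total (range (length M)) F
    by-length inv {M} M⊆ = total-sorted inv (AllPairs-⊆ M⊆ (range-sorted n)) (range-sorted (length M))
      (sym (range-length (length M)))

-- The recurrence

open import Data.Nat using (_+_; _*_)
open ≡-Reasoning

-- Position j carries the strict minimum. Earlier entries need only exceed some later entry, which
-- one comparison with a nearby entry provides; this suits the recursive tests in `partial` and
-- `peeled`.
MinAt : ℕ → List ℕ → Set
MinAt j       []      = ⊥
MinAt zero    (x ∷ σ) = All (x <_) σ
MinAt (suc j) (x ∷ σ) = Any (_< x) σ × MinAt j σ

SupportedOn : ℕ → (List ℕ → ℕ) → Set
SupportedOn j F = ∀ σ → F σ ≡ 0 ⊎ MinAt j σ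

insertAt : ℕ → ℕ → List ℕ → List ℕ
insertAt zero    x σ       = x ∷ σ
insertAt (suc j) x []      = x ∷ []
insertAt (suc j) x (y ∷ σ) = y ∷ insertAt j x σ

-- A new least letter can stand only where `F` expects its minimum; every other position contributes
-- 0.
ins-min : ∀ {m} j (F : List ℕ → ℕ) → SupportedOn j F → ∀ {σ} → All (m <_) σ → ℕW.ins m F σ ≡ F (insertAt j m σ)
ins-min zero    F supp {[]} _ = ℕ.+-identityʳ _
ins-min (suc j) F supp {[]} _ = ℕ.+-identityʳ _
ins-min {m} zero F supp {y ∷ σ} (m<y ∷ _) = begin
  ℕW.ins m F (y ∷ σ)                           ≡⟨ ℕW.ins-∷ m F y σ ⟩
  F (m ∷ y ∷ σ) + ℕW.ins m (F ∘ (y ∷_)) σ      ≡⟨ cong (F (m ∷ y ∷ σ) +_) (ℕW.sumOver-0 (inserts m σ) later) ⟩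
  F (m ∷ y ∷ σ) + 0                            ≡⟨ ℕ.+-identityʳ _ ⟩
  F (m ∷ y ∷ σ)                                ∎
  where
  later : ∀ {τ} → τ ∈ inserts m σ → F (y ∷ τ) ≡ 0
  later {τ} τ∈ with supp (y ∷ τ)
  ... | inj₁ eq  = eq
  ... | inj₂ min = contradiction m<y (ℕ.<-asym (All.lookup min (∈-resp-↭ (↭-sym (∈-inserts⇒↭ σ τ∈)) (here refl))))
ins-min {m} (suc j) F supp {y ∷ σ} (m<y ∷ m<σ) = begin
  ℕW.ins m F (y ∷ σ)                           ≡⟨ ℕW.ins-∷ m F y σ ⟩
  F (m ∷ y ∷ σ) + ℕW.ins m (F ∘ (y ∷_)) σ      ≡⟨ cong₂ _+_ first (ins-min j (F ∘ (y ∷_)) supp′ m<σ) ⟩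
  F (y ∷ insertAt j m σ)                       ∎
  where
  first : F (m ∷ y ∷ σ) ≡ 0
  first with supp (m ∷ y ∷ σ)
  ... | inj₁ eq        = eq
  ... | inj₂ (any , _) = contradiction any (All.All¬⇒¬Any (ℕ.<-asym m<y ∷ All.map ℕ.<-asym m<σ))
  supp′ : SupportedOn j (F ∘ (y ∷_))
  supp′ τ with supp (y ∷ τ)
  ... | inj₁ eq        = inj₁ eq
  ... | inj₂ (_ , min) = inj₂ min

count-peel : ∀ {m L} j {F G : List ℕ → ℕ} → SupportedOn j F → All (m <_) L →
  (∀ {σ} → All (m <_) σ → F (insertAt j m σ) ≡ G σ) → count (m ∷ L) F ≡ count L G
count-peel {m} {L} j {F} supp m<L eq = trans (ℕW.total-∷ m L F)
  (ℕW.total-cong L λ σ↭L → let m<σ = All-resp-↭ (↭-sym σ↭L) m<L in trans (ins-min j F supp m<σ) (eq m<σ))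

if-0 : ∀ b {x : ℕ} → x ≡ 0 → (if b then x else 0) ≡ 0
if-0 true  eq = eq
if-0 false eq = refl

if-supported : ∀ b {x : ℕ} {P : Set} → (b ≡ true → x ≡ 0 ⊎ P) → (if b then x else 0) ≡ 0 ⊎ P
if-supported true  h = h refl
if-supported false h = inj₁ refl

∧-true : ∀ {a b} → a ∧ b ≡ true → a ≡ true × b ≡ true
∧-true {true} {true} _ = refl , refl

δ : ℕ → ℕ → ℕ
δ k n = χ (k ≡ᵇ n)

-- `δ k` selects the left parts of size k, so a single term of the convolution survives.
binom-δ : ∀ k (g : ℕ → ℕ) n → ℕW.binom (δ k) g n ≡ (n C k) * g (n ∸ k)
binom-δ zero    g zero    = refl
binom-δ (suc k) g zero    = refl
binom-δ zero    g (suc n) = cong₂ _+_ (binom-0 g n) (binom-δ zero (g ∘ suc) n)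
  where
  binom-0 : ∀ g n → ℕW.binom (λ _ → 0) g n ≡ 0
  binom-0 g zero    = refl
  binom-0 g (suc n) = cong₂ _+_ (binom-0 g n) (binom-0 (g ∘ suc) n)
binom-δ (suc k) g (suc n) = begin
  ℕW.binom (δ k) g n + ℕW.binom (δ (suc k)) (g ∘ suc) n
    ≡⟨ cong₂ _+_ (binom-δ k g n) (trans (binom-δ (suc k) (g ∘ suc) n) shift-index) ⟩
  (n C k) * g (n ∸ k) + (n C suc k) * g (n ∸ k)
    ≡⟨ ℕ.*-distribʳ-+ (g (n ∸ k)) (n C k) (n C suc k) ⟨
  (n C k + n C suc k) * g (n ∸ k)
    ≡⟨ cong (_* g (n ∸ k)) (nCk+nC[k+1]≡[n+1]C[k+1] n k) ⟩
  (suc n C suc k) * g (n ∸ k) ∎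
  where
  shift-index : (n C suc k) * g (suc (n ∸ suc k)) ≡ (n C suc k) * g (n ∸ k)
  shift-index with suc k ≤? n
  ... | yes k<n = cong (λ x → (n C suc k) * g x) (sym (ℕ.+-∸-assoc 1 k<n))
  ... | no  k≮n rewrite k>n⇒nCk≡0 (ℕ.≰⇒> k≮n) = refl

desc : List ℕ → ℕ
desc []          = 1
desc (x ∷ [])    = 1
desc (x ∷ y ∷ σ) = if y <ᵇ x then desc (y ∷ σ) else 0

-- Inserting a least letter anywhere but at the end creates an ascent, and at the end it leaves
-- `desc` unchanged.
count-desc : ∀ {L} → Sorted L → count L desc ≡ 1
count-desc []                = refl
count-desc {m ∷ L} (m<L ∷ s) =
  trans (ℕW.total-∷ m L desc)
    (trans (ℕW.total-cong L (λ {σ} σ↭L → ins-desc σ (All-resp-↭ (↭-sym σ↭L) m<L))) (count-desc s))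
  where
  ins-tail : ∀ y σ → m < y → All (m <_) σ → ℕW.ins m (desc ∘ (y ∷_)) σ ≡ desc (y ∷ σ)
  ins-tail y []      m<y _ rewrite <⇒<ᵇ≡true m<y = refl
  ins-tail y (z ∷ σ) m<y (m<z ∷ m<σ) = begin
    ℕW.ins m (desc ∘ (y ∷_)) (z ∷ σ)
      ≡⟨ ℕW.ins-∷ m (desc ∘ (y ∷_)) z σ ⟩
    desc (y ∷ m ∷ z ∷ σ) + ℕW.ins m (λ τ → if z <ᵇ y then desc (z ∷ τ) else 0) σ
      ≡⟨ cong₂ _+_ (if-0 (m <ᵇ y) (cong (λ b → if b then desc (z ∷ σ) else 0) z≮m)) (∑-if (z <ᵇ y)) ⟩
    (if z <ᵇ y then desc (z ∷ σ) else 0) ∎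
    where
    z≮m : (z <ᵇ m) ≡ false
    z≮m = ≥⇒<ᵇ≡false (ℕ.<⇒≤ m<z)
    ∑-if : ∀ b → ℕW.ins m (λ τ → if b then desc (z ∷ τ) else 0) σ ≡ (if b then desc (z ∷ σ) else 0)
    ∑-if true  = ins-tail z σ m<z m<σ
    ∑-if false = ℕW.sumOver-0 (inserts m σ) (λ _ → refl)
  ins-desc : ∀ σ → All (m <_) σ → ℕW.ins m desc σ ≡ desc σ
  ins-desc []      _           = refl
  ins-desc (y ∷ σ) (m<y ∷ m<σ) = trans (ℕW.ins-∷ m desc y σ) (cong₂ _+_
    (cong (λ b → if b then desc (y ∷ σ) else 0) (≥⇒<ᵇ≡false (ℕ.<⇒≤ m<y))) (ins-tail y σ m<y m<σ))

-- The value 0 on words that are too short is never relevant: the weights below vanish there.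
head₀ : List ℕ → ℕ
head₀ []      = 0
head₀ (x ∷ _) = x

second₀ : List ℕ → ℕ
second₀ []      = 0
second₀ (_ ∷ σ) = head₀ σ

-- A word a₁ b₁ a₂ b₂ … a_k b_k a_{k+1} ρ whose first k windows at odd positions have pattern 1423
-- satisfies a₁ < … < a_{k+1} < ρ₁ < b_k < … < b₁; the tail ρ is weighted by Q.
module Runs (Q : List ℕ → ℕ) (Q-supp : SupportedOn 0 Q) where

  Q[]≡0 : Q [] ≡ 0
  Q[]≡0 with Q-supp []
  ... | inj₁ eq = eq

  run : ℕ → List ℕ → ℕ
  run k       []                  = 0
  run k       (x ∷ [])            = 0
  run zero    (x ∷ y ∷ σ)         = if x <ᵇ y then Q (y ∷ σ) else 0
  run (suc k) (a ∷ b ∷ [])        = 0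
  run (suc k) (a ∷ b ∷ c ∷ [])    = 0
  -- The remaining inequality c < d of the window is supplied by `run k`: where that is nonzero, c
  -- is the least entry.
  run (suc k) (a ∷ b ∷ c ∷ d ∷ σ) = if (a <ᵇ c) ∧ (d <ᵇ b) then run k (c ∷ d ∷ σ) else 0

  -- Makes the counts vanish for those k that the filter in `recRHS` leaves out.
  run-length : ∀ k σ → run k σ ≡ 0 ⊎ 2 * k + 2 ≤ length σ
  run-length k       []                  = inj₁ refl
  run-length k       (x ∷ [])            = inj₁ refl
  run-length zero    (x ∷ y ∷ σ)         = inj₂ (s≤s (s≤s z≤n))
  run-length (suc k) (a ∷ b ∷ [])        = inj₁ refl
  run-length (suc k) (a ∷ b ∷ c ∷ [])    = inj₁ refl
  run-length (suc k) (a ∷ b ∷ c ∷ d ∷ σ) = if-supported ((a <ᵇ c) ∧ (d <ᵇ b)) λ _ → rec (run-length k (c ∷ d ∷ σ))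
    where
    rec : run k (c ∷ d ∷ σ) ≡ 0 ⊎ 2 * k + 2 ≤ 2 + length σ →
          run k (c ∷ d ∷ σ) ≡ 0 ⊎ 2 * suc k + 2 ≤ 4 + length σ
    rec (inj₁ eq) = inj₁ eq
    rec (inj₂ le) = inj₂ (subst (_≤ 4 + length σ)
      (cong (_+ 2) (sym (cong suc (ℕ.+-suc k (k + 0))))) (s≤s (s≤s le)))

  run-supp : ∀ k → SupportedOn 0 (run k)
  run-supp k       []                  = inj₁ refl
  run-supp k       (x ∷ [])            = inj₁ refl
  run-supp zero    (x ∷ y ∷ σ)         = if-supported (x <ᵇ y) λ x<y → rec (<ᵇ≡true⇒< {x} {y} x<y) (Q-supp (y ∷ σ))
    where
    rec : x < y → Q (y ∷ σ) ≡ 0 ⊎ All (y <_) σ → Q (y ∷ σ) ≡ 0 ⊎ All (x <_) (y ∷ σ)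
    rec x<y (inj₁ eq)  = inj₁ eq
    rec x<y (inj₂ y<σ) = inj₂ (x<y ∷ All.map (ℕ.<-trans x<y) y<σ)
  run-supp (suc k) (a ∷ b ∷ [])        = inj₁ refl
  run-supp (suc k) (a ∷ b ∷ c ∷ [])    = inj₁ refl
  run-supp (suc k) (a ∷ b ∷ c ∷ d ∷ σ) = if-supported ((a <ᵇ c) ∧ (d <ᵇ b)) λ eq →
      let a<c , d<b = ∧-true {a <ᵇ c} {d <ᵇ b} eq
      in rec (<ᵇ≡true⇒< {a} {c} a<c) (<ᵇ≡true⇒< {d} {b} d<b) (run-supp k (c ∷ d ∷ σ))
    where
    rec : a < c → d < b → run k (c ∷ d ∷ σ) ≡ 0 ⊎ All (c <_) (d ∷ σ) →
          run k (c ∷ d ∷ σ) ≡ 0 ⊎ All (a <_) (b ∷ c ∷ d ∷ σ)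
    rec a<c d<b (inj₁ eq)           = inj₁ eq
    rec a<c d<b (inj₂ (c<d ∷ c<σ)) = inj₂
      (ℕ.<-trans (ℕ.<-trans a<c c<d) d<b ∷ a<c ∷ All.map (ℕ.<-trans a<c) (c<d ∷ c<σ))

  -- The words left over from a run of length j + k when its j smallest entries a₁, …, a_j are deleted.
  partial : ℕ → ℕ → List ℕ → ℕ
  partial zero          k σ       = run k σ
  partial (suc j)       k []      = 0
  partial (suc zero)    k (b ∷ σ) = if second₀ σ <ᵇ b then run k σ else 0
  partial (suc (suc j)) k (b ∷ σ) = if head₀ σ <ᵇ b then partial (suc j) k σ else 0

  -- The same with all of a₁, …, a_{j+1} deleted.
  peeled : ℕ → List ℕ → ℕ
  peeled zero    σ       = Q σ
  peeled (suc j) []      = 0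
  peeled (suc j) (b ∷ σ) = if head₀ σ <ᵇ b then peeled j σ else 0

  partial-supp : ∀ j k → SupportedOn j (partial j k)
  partial-supp zero          k σ               = run-supp k σ
  partial-supp (suc j)       k []              = inj₁ refl
  partial-supp (suc zero)    k (b ∷ [])        = inj₁ (if-0 (0 <ᵇ b) refl)
  partial-supp (suc zero)    k (b ∷ c ∷ [])    = inj₁ (if-0 (0 <ᵇ b) refl)
  partial-supp (suc zero)    k (b ∷ c ∷ d ∷ σ) = if-supported (d <ᵇ b) λ d<b → rec (<ᵇ≡true⇒< {d} {b} d<b) (run-supp k (c ∷ d ∷ σ))
    where
    rec : d < b → run k (c ∷ d ∷ σ) ≡ 0 ⊎ MinAt 0 (c ∷ d ∷ σ) → run k (c ∷ d ∷ σ) ≡ 0 ⊎ MinAt 1 (b ∷ c ∷ d ∷ σ)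
    rec d<b (inj₁ eq)  = inj₁ eq
    rec d<b (inj₂ min) = inj₂ (there (here d<b) , min)
  partial-supp (suc (suc j)) k (b ∷ [])        = inj₁ (if-0 (0 <ᵇ b) refl)
  partial-supp (suc (suc j)) k (b ∷ c ∷ σ)     = if-supported (c <ᵇ b) λ c<b → rec (<ᵇ≡true⇒< {c} {b} c<b) (partial-supp (suc j) k (c ∷ σ))
    where
    rec : c < b → partial (suc j) k (c ∷ σ) ≡ 0 ⊎ MinAt (suc j) (c ∷ σ) →
          partial (suc j) k (c ∷ σ) ≡ 0 ⊎ MinAt (suc (suc j)) (b ∷ c ∷ σ)
    rec c<b (inj₁ eq)  = inj₁ eq
    rec c<b (inj₂ min) = inj₂ (here c<b , min)

  peeled-[] : ∀ j → peeled j [] ≡ 0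
  peeled-[] zero    = Q[]≡0
  peeled-[] (suc j) = refl

  peeled-supp : ∀ j → SupportedOn j (peeled j)
  peeled-supp zero    σ           = Q-supp σ
  peeled-supp (suc j) []          = inj₁ refl
  peeled-supp (suc j) (b ∷ [])    = inj₁ (if-0 (0 <ᵇ b) (peeled-[] j))
  peeled-supp (suc j) (b ∷ c ∷ σ) = if-supported (c <ᵇ b) λ c<b → rec (<ᵇ≡true⇒< {c} {b} c<b) (peeled-supp j (c ∷ σ))
    where
    rec : c < b → peeled j (c ∷ σ) ≡ 0 ⊎ MinAt j (c ∷ σ) → peeled j (c ∷ σ) ≡ 0 ⊎ MinAt (suc j) (b ∷ c ∷ σ)
    rec c<b (inj₁ eq)  = inj₁ eq
    rec c<b (inj₂ min) = inj₂ (here c<b , min)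

  -- The letter m is a_{j+1} in b₁ ... b_j a_{j+1} b_{j+1} a_{j+2} .... Being least, it passes its
  -- test against a_{j+2}; the test on b_{j+1} survives in the shorter word.
  partial-insert : ∀ j k {m σ} → All (m <_) σ → partial j (suc k) (insertAt j m σ) ≡ partial (suc j) k σ
  partial-insert zero k {σ = []}            _ = refl
  partial-insert zero k {σ = b ∷ []}        _ = sym (if-0 (0 <ᵇ b) refl)
  partial-insert zero k {σ = b ∷ c ∷ []}    _ = sym (if-0 (0 <ᵇ b) refl)
  partial-insert zero k {σ = b ∷ c ∷ d ∷ σ} (_ ∷ m<c ∷ _) rewrite <⇒<ᵇ≡true m<c = refl
  partial-insert (suc zero)    k {m} {[]}     _ = if-0 (0 <ᵇ m) refl
  partial-insert (suc (suc j)) k {m} {[]}     _ = if-0 (0 <ᵇ m) refl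
  partial-insert (suc zero)    k {m} {b ∷ []} _ =
    trans (if-0 (0 <ᵇ b) refl) (sym (if-0 (0 <ᵇ b) refl))
  partial-insert (suc zero)    k {m} {b ∷ c ∷ σ} (_ ∷ m<σ) =
    cong (λ x → if c <ᵇ b then x else 0) (partial-insert zero k {m} {c ∷ σ} m<σ)
  partial-insert (suc (suc j)) k {m} {b ∷ []} _ =
    trans (if-0 (m <ᵇ b) (partial-insert (suc j) k {m} {[]} [])) (sym (if-0 (0 <ᵇ b) refl))
  partial-insert (suc (suc j)) k {m} {b ∷ c ∷ σ} (_ ∷ m<σ) =
    cong (λ x → if c <ᵇ b then x else 0) (partial-insert (suc j) k {m} {c ∷ σ} m<σ)

  -- Here m is the last of the a's, directly in front of ρ, and its test against ρ₁ holds because m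
  -- is least.
  partial-insert-last : ∀ j {m σ} → All (m <_) σ → partial j 0 (insertAt j m σ) ≡ peeled j σ
  partial-insert-last zero {σ = []}    _ = sym Q[]≡0
  partial-insert-last zero {σ = y ∷ σ} (m<y ∷ _) rewrite <⇒<ᵇ≡true m<y = refl
  partial-insert-last (suc zero)    {m} {[]}     _ = if-0 (0 <ᵇ m) refl
  partial-insert-last (suc (suc j)) {m} {[]}     _ = if-0 (0 <ᵇ m) refl
  partial-insert-last (suc zero)    {m} {b ∷ []} _ =
    trans (if-0 (0 <ᵇ b) refl) (sym (if-0 (0 <ᵇ b) Q[]≡0))
  partial-insert-last (suc zero)    {m} {b ∷ c ∷ σ} (_ ∷ m<σ) =
    cong (λ x → if c <ᵇ b then x else 0) (partial-insert-last zero {m} {c ∷ σ} m<σ)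
  partial-insert-last (suc (suc j)) {m} {b ∷ []} _ =
    trans (if-0 (m <ᵇ b) (partial-insert-last (suc j) {m} {[]} [])) (sym (if-0 (0 <ᵇ b) refl))
  partial-insert-last (suc (suc j)) {m} {b ∷ c ∷ σ} (_ ∷ m<σ) =
    cong (λ x → if c <ᵇ b then x else 0) (partial-insert-last (suc j) {m} {c ∷ σ} m<σ)

  descending : ℕ → List ℕ → ℕ
  descending j σ = δ j (length σ) * desc σ

  -- Here d is ρ₁. It lies below all other letters, so the comparison of the last b with it is
  -- automatic, and what remains is that the first j letters descend. The factor `δ` in `descending`
  -- singles out the cut after j letters.
  peeled-insert : ∀ j {d σ} → All (d <_) σ → peeled j (insertAt j d σ) ≡ ℕW.conv (descending j) (Q ∘ (d ∷_)) σ
  peeled-insert zero {d} {[]}    _ = sym (ℕ.+-identityʳ (Q (d ∷ [])))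
  peeled-insert zero {d} {x ∷ σ} _ = begin
    Q (d ∷ x ∷ σ)
      ≡⟨ ℕ.+-identityʳ _ ⟨
    Q (d ∷ x ∷ σ) + 0
      ≡⟨ cong₂ _+_ (ℕ.*-identityˡ (Q (d ∷ x ∷ σ))) (ℕW.conv-0ˡ (Q ∘ (d ∷_)) (λ _ → refl) σ) ⟨
    1 * Q (d ∷ x ∷ σ) + ℕW.conv (descending 0 ∘ (x ∷_)) (Q ∘ (d ∷_)) σ ∎
  peeled-insert (suc j) {d} {[]}    _           = if-0 (0 <ᵇ d) (peeled-[] j)
  peeled-insert (suc j) {d} {b ∷ σ} (d<b ∷ d<σ) =
    trans (cong (λ x → if head₀ (insertAt j d σ) <ᵇ b then x else 0) (peeled-insert j d<σ)) (step j σ)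
    where
    step : ∀ j σ → (if head₀ (insertAt j d σ) <ᵇ b then ℕW.conv (descending j) (Q ∘ (d ∷_)) σ else 0)
                 ≡ ℕW.conv (λ τ → δ j (length τ) * desc (b ∷ τ)) (Q ∘ (d ∷_)) σ
    step zero σ rewrite <⇒<ᵇ≡true d<b = ℕW.conv-congˡ (Q ∘ (d ∷_)) (λ { [] → refl ; (_ ∷ _) → refl }) σ
    step (suc j) []      = if-0 (d <ᵇ b) refl
    step (suc j) (c ∷ σ) with c <ᵇ b
    ... | true  = refl
    ... | false = sym (ℕW.conv-0ˡ (Q ∘ (d ∷_)) (λ τ → ℕ.*-zeroʳ (δ j (length τ))) σ)

  -- Deletes the k least letters one after another. Each deletion moves the position of the minimum
  -- one to the right, past the b that now precedes it. Of the remaining letters only order and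
  -- number matter, hence the existential.
  count-partial : ∀ k j s {L} → Sorted L → length L ≡ k + s →
    ∃ λ M → Sorted M × length M ≡ s × count L (partial j k) ≡ count M (partial (j + k) 0)
  count-partial zero    j s {L}     sL         len = L , sL , len , cong (λ i → count L (partial i 0)) (sym (ℕ.+-identityʳ j))
  count-partial (suc k) j s {m ∷ L} (m<L ∷ sL) len with count-partial k (suc j) s sL (ℕ.suc-injective len)
  ... | M , sM , lenM , eq = M , sM , lenM , (begin
    count (m ∷ L) (partial j (suc k))   ≡⟨ count-peel j (partial-supp j (suc k)) m<L (partial-insert j k) ⟩
    count L (partial (suc j) k)         ≡⟨ eq ⟩
    count M (partial (suc j + k) 0)     ≡⟨ cong (λ i → count M (partial i 0)) (sym (ℕ.+-suc j k)) ⟩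
    count M (partial (j + suc k) 0)     ∎)

  -- The length k + (2 + (k + s)) counts a₁ ... a_k, then a_{k+1} and ρ₁, then b₁ ... b_k, then the
  -- s entries of ρ after its first.
  count-run : ℕW.OrderInvariant Q → ∀ k s {L} → Sorted L → length L ≡ k + (2 + (k + s)) →
    count L (run k) ≡ ((k + s) C k) * count (range (suc s)) Q
  count-run Q-inv k s {L} sL len with count-partial k 0 (2 + (k + s)) sL len
  ... | a ∷ d ∷ M , ((a<d ∷ a<M) ∷ (d<M ∷ sM)) , lenM , eq = begin
    count L (run k)
      ≡⟨ eq ⟩
    count (a ∷ d ∷ M) (partial k 0)
      ≡⟨ count-peel k (partial-supp k 0) (a<d ∷ a<M) (partial-insert-last k) ⟩
    count (d ∷ M) (peeled k)
      ≡⟨ count-peel k (peeled-supp k) d<M (peeled-insert k) ⟩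
    count M (ℕW.conv (descending k) (Q ∘ (d ∷_)))
      ≡⟨ ℕW.total-conv (descending k) (Q ∘ (d ∷_)) M ⟩
    ℕW.splits (λ A → count A (descending k)) (λ B → count B (Q ∘ (d ∷_))) M
      ≡⟨ ℕW.splits-length M count-descending count-Q ⟩
    ℕW.binom (δ k) (λ i → count (range (suc i)) Q) (length M)
      ≡⟨ cong (ℕW.binom (δ k) (λ i → count (range (suc i)) Q)) (ℕ.suc-injective (ℕ.suc-injective lenM)) ⟩
    ℕW.binom (δ k) (λ i → count (range (suc i)) Q) (k + s)
      ≡⟨ binom-δ k (λ i → count (range (suc i)) Q) (k + s) ⟩
    ((k + s) C k) * count (range (suc (k + s ∸ k))) Q
      ≡⟨ cong (λ i → ((k + s) C k) * count (range (suc i)) Q) (ℕ.m+n∸m≡n k s) ⟩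
    ((k + s) C k) * count (range (suc s)) Q ∎
    where
    count-descending : ∀ {A} → A ⊆ M → count A (descending k) ≡ δ k (length A)
    count-descending {A} A⊆M = begin
      count A (descending k)               ≡⟨ ℕW.total-cong A (λ {σ} p → cong (λ i → δ k i * desc σ) (↭-length p)) ⟩
      count A (λ σ → δ k (length A) * desc σ) ≡⟨ ℕW.sumOver-*ˡ (arrangements A) (δ k (length A)) desc ⟩
      δ k (length A) * count A desc        ≡⟨ cong (δ k (length A) *_) (count-desc (AllPairs-⊆ A⊆M sM)) ⟩
      δ k (length A) * 1                   ≡⟨ ℕ.*-identityʳ _ ⟩
      δ k (length A)                       ∎
    count-Q : ∀ {B} → B ⊆ M → count B (Q ∘ (d ∷_)) ≡ count (range (suc (length B))) Q
    count-Q {B} B⊆M = begin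
      -- The deleted ρ₁ is put back: d lies below all of B, so peeling at position 0 can be read
      -- backwards.
      count B (Q ∘ (d ∷_))                 ≡⟨ count-peel 0 Q-supp d<B (λ _ → refl) ⟨
      count (d ∷ B) Q                      ≡⟨ ℕW.total-sorted Q-inv (d<B ∷ AllPairs-⊆ B⊆M sM)
                                                (range-sorted (suc (length B))) (sym (range-length (suc (length B)))) ⟩
      count (range (suc (length B))) Q     ∎
      where
      d<B : All (d <_) B
      d<B = All-resp-⊆ B⊆M d<M

-- Rules out shift 1: a window starting at b would need b < d, while the window before it has d < b.
clusters-no-shift : ∀ {b c d} σ q → d < b → clusters (b ∷ c ∷ d ∷ σ) q ≡ 0
clusters-no-shift []      q       d<b = refl
clusters-no-shift (e ∷ σ) zero    d<b = refl
clusters-no-shift {b} {c} {d} (e ∷ σ) (suc q) d<b rewrite ≥⇒<ᵇ≡false {b} {d} (ℕ.<⇒≤ d<b) = refl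

-- A window has a < c < d < b, and the next piece starts at c or d, which by induction is least in
-- what follows.
clusters-supp : ∀ q → SupportedOn 0 (λ σ → clusters σ q)
clusters-supp q       []               = inj₁ refl
clusters-supp q       (_ ∷ [])         = inj₂ []
clusters-supp q       (_ ∷ _ ∷ [])     = inj₁ refl
clusters-supp q       (_ ∷ _ ∷ _ ∷ []) = inj₁ refl
clusters-supp zero    (_ ∷ _ ∷ _ ∷ _ ∷ _) = inj₁ refl
clusters-supp (suc q) (a ∷ b ∷ c ∷ d ∷ σ) = if-supported (inOrder a b c d) λ eq →
    rec (inOrder⇒< {a} {b} {c} {d} eq) (clusters-supp q (c ∷ d ∷ σ)) (clusters-supp q (d ∷ σ))
  where
  rec : a < c × c < d × d < b →
    clusters (c ∷ d ∷ σ) q ≡ 0 ⊎ All (c <_) (d ∷ σ) → clusters (d ∷ σ) q ≡ 0 ⊎ All (d <_) σ →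
    clusters (b ∷ c ∷ d ∷ σ) q + (clusters (c ∷ d ∷ σ) q + clusters (d ∷ σ) q) ≡ 0 ⊎ All (a <_) (b ∷ c ∷ d ∷ σ)
  rec (a<c , c<d , d<b) = λ where
      (inj₁ eq₁)         (inj₁ eq₂) → inj₁ (cong₂ _+_ (clusters-no-shift σ q d<b) (cong₂ _+_ eq₁ eq₂))
      (inj₁ _)           (inj₂ d<σ) → inj₂ (below (All.map (ℕ.<-trans c<d) d<σ))
      (inj₂ (_ ∷ c<σ)) _          → inj₂ (below c<σ)
    where
    below : All (c <_) σ → All (a <_) (b ∷ c ∷ d ∷ σ)
    below c<σ = ℕ.<-trans a<c (ℕ.<-trans c<d d<b) ∷ a<c ∷ All.map (ℕ.<-trans a<c) (c<d ∷ c<σ)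

-- The recurrence subtracts k from an arbitrary integer l; the value 0 at negative integers is the
-- convention of `c`.
clustersℤ : ℤ → List ℕ → ℕ
clustersℤ (ℤ.+ q)  σ = clusters σ q
clustersℤ -[1+ q ] σ = 0

clustersℤ-supp : ∀ l → SupportedOn 0 (clustersℤ l)
clustersℤ-supp (ℤ.+ q)  σ = clusters-supp q σ
clustersℤ-supp -[1+ q ] σ = inj₁ refl

clustersℤ-orderInvariant : ∀ l → ℕW.OrderInvariant (clustersℤ l)
clustersℤ-orderInvariant (ℤ.+ q)  = clusters-orderInvariant q
clustersℤ-orderInvariant -[1+ q ] = λ _ _ → refl

c-count : ∀ n l → 1 ≤ n → c n l ≡ count (range n) (clustersℤ l)
c-count (suc zero)    (ℤ.+ zero)  _ = refl
c-count (suc zero)    (ℤ.+ suc _) _ = refl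
c-count (suc zero)    -[1+ _ ]    _ = refl
c-count (suc (suc n)) (ℤ.+ q)     _ = numClusters-count (2 + n) q (s≤s (s≤s z≤n))
c-count (suc (suc n)) -[1+ q ]    _ = sym (ℕW.sumOver-0 (arrangements (range (2 + n))) (λ _ → refl))

-- Decomposition of a cluster by its initial run of shifts 2

module RunsOf (l : ℤ) = Runs (clustersℤ l) (clustersℤ-supp l)
open RunsOf using (run)

-- The summand with `run` is shift 3, where the run stops and the tail starts at d; the other
-- summand is shift 2, where the run continues at c.
clustersℤ-step : ∀ l a b c d σ → clustersℤ l (a ∷ b ∷ c ∷ d ∷ σ) ≡
  (if (a <ᵇ c) ∧ (d <ᵇ b)
     then run (l ℤ.- ℤ.+ 1) 0 (c ∷ d ∷ σ) + clustersℤ (l ℤ.- ℤ.+ 1) (c ∷ d ∷ σ) else 0)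
clustersℤ-step -[1+ q ]     a b c d σ = sym (if-0 ((a <ᵇ c) ∧ (d <ᵇ b)) (cong (_+ 0) (if-0 (c <ᵇ d) refl)))
clustersℤ-step (ℤ.+ zero)   a b c d σ = sym (if-0 ((a <ᵇ c) ∧ (d <ᵇ b)) (cong (_+ 0) (if-0 (c <ᵇ d) refl)))
clustersℤ-step (ℤ.+ suc q)  a b c d σ with a <ᵇ c | c <ᵇ d in c<d | d <ᵇ b in d<b
... | false | _     | _     = refl
... | true  | true  | false = refl
... | true  | false | false = refl
... | true  | true  | true  = cong₂ _+_ (clusters-no-shift σ q (<ᵇ≡true⇒< {d} {b} d<b)) (ℕ.+-comm (clusters (c ∷ d ∷ σ) q) _)
-- Here c < d fails, so no occurrence starts at a. The right-hand side does not test this, but a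
-- cluster starting at c would make c least, so its count is 0 as well.
... | true  | false | true  with clusters-supp q (c ∷ d ∷ σ)
...   | inj₁ eq = sym eq
...   | inj₂ (c<d′ ∷ _) with () ← trans (sym (<⇒<ᵇ≡true c<d′)) c<d

-- Unfolds `clustersℤ-step` along shifts 2 until the run stops; the integer passed to `run` is the
-- number of occurrences left for the tail. Each step uses two letters, so N summands suffice.
clustersℤ-runs : ∀ N l σ → 2 ≤ length σ → length σ ≤ N →
  clustersℤ l σ ≡ ∑ (upTo N) (λ k → run (l ℤ.- ℤ.+ suc k) (suc k) σ)
clustersℤ-runs N l (_ ∷ [])         (s≤s ()) _
clustersℤ-runs N l σ@(_ ∷ _ ∷ [])     _ _ = trans (short l) (sym (ℕW.sumOver-0 (upTo N) (λ _ → refl)))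
  where
  short : ∀ l → clustersℤ l σ ≡ 0
  short (ℤ.+ q)  = refl
  short -[1+ q ] = refl
clustersℤ-runs N l σ@(_ ∷ _ ∷ _ ∷ []) _ _ = trans (short l) (sym (ℕW.sumOver-0 (upTo N) (λ _ → refl)))
  where
  short : ∀ l → clustersℤ l σ ≡ 0
  short (ℤ.+ q)  = refl
  short -[1+ q ] = refl
clustersℤ-runs (suc N) l (a ∷ b ∷ c ∷ d ∷ σ) _ (s≤s len≤) = begin
  clustersℤ l (a ∷ b ∷ c ∷ d ∷ σ)
    ≡⟨ clustersℤ-step l a b c d σ ⟩
  (if o then run l′ 0 (c ∷ d ∷ σ) + clustersℤ l′ (c ∷ d ∷ σ) else 0)
    ≡⟨ cong (λ x → if o then run l′ 0 (c ∷ d ∷ σ) + x else 0)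
         (clustersℤ-runs N l′ (c ∷ d ∷ σ) (s≤s (s≤s z≤n)) (ℕ.≤-trans (ℕ.n≤1+n _) len≤)) ⟩
  (if o then run l′ 0 (c ∷ d ∷ σ) + ∑ (upTo N) (λ k → run (l′ ℤ.- ℤ.+ suc k) (suc k) (c ∷ d ∷ σ)) else 0)
    ≡⟨ distribute o ⟩
  run l′ 1 (a ∷ b ∷ c ∷ d ∷ σ) + ∑ (upTo N) (λ k → run (l′ ℤ.- ℤ.+ suc k) (2 + k) (a ∷ b ∷ c ∷ d ∷ σ))
    ≡⟨ cong (run l′ 1 (a ∷ b ∷ c ∷ d ∷ σ) +_)
         (ℕW.sumOver-cong (upTo N) (λ {k} _ → cong (λ z → run z (2 + k) (a ∷ b ∷ c ∷ d ∷ σ)) (ℤ.+-assoc l (-[1+ 0 ]) (-[1+ k ])))) ⟩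
  run l′ 1 (a ∷ b ∷ c ∷ d ∷ σ) + ∑ (upTo N) (λ k → run (l ℤ.- ℤ.+ (2 + k)) (2 + k) (a ∷ b ∷ c ∷ d ∷ σ))
    ≡⟨ ℕW.sumOver-upTo-suc N (λ k → run (l ℤ.- ℤ.+ suc k) (suc k) (a ∷ b ∷ c ∷ d ∷ σ)) ⟨
  ∑ (upTo (suc N)) (λ k → run (l ℤ.- ℤ.+ suc k) (suc k) (a ∷ b ∷ c ∷ d ∷ σ)) ∎
  where
  l′ : ℤ
  l′ = l ℤ.- ℤ.+ 1
  o : Bool
  o = (a <ᵇ c) ∧ (d <ᵇ b)
  distribute : ∀ o {x} {h : ℕ → ℕ} →
    (if o then x + ∑ (upTo N) h else 0) ≡ (if o then x else 0) + ∑ (upTo N) (λ k → if o then h k else 0)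
  distribute true  = refl
  distribute false = sym (ℕW.sumOver-0 (upTo N) (λ _ → refl))

count-run-term : ∀ n l k → 2 * k + 2 ≤ n →
  ((n ∸ k ∸ 2) C k) * c (n ∸ 2 * k ∸ 1) (l ℤ.- ℤ.+ k) ≡ count (range n) (run (l ℤ.- ℤ.+ k) k)
count-run-term n l k le = begin
  ((n ∸ k ∸ 2) C k) * c (n ∸ 2 * k ∸ 1) l′
    ≡⟨ cong₂ (λ x y → (x C k) * c y l′) e₁ e₂ ⟩
  ((k + s) C k) * c (suc s) l′
    ≡⟨ cong (((k + s) C k) *_) (c-count (suc s) l′ (s≤s z≤n)) ⟩
  ((k + s) C k) * count (range (suc s)) (clustersℤ l′)
    ≡⟨ RunsOf.count-run l′ (clustersℤ-orderInvariant l′) k s (range-sorted n) (trans (range-length n) n≡) ⟨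
  count (range n) (run l′ k) ∎
  where
  l′ : ℤ
  l′ = l ℤ.- ℤ.+ k
  -- The number of entries of the tail after its first, so the tail has s + 1 = n - 2k - 1 entries.
  s : ℕ
  s = n ∸ (2 * k + 2)
  open +-*-Solver
  n≡₂ : n ≡ 2 * k + (2 + s)
  n≡₂ = trans (sym (ℕ.m+[n∸m]≡n le)) (ℕ.+-assoc (2 * k) 2 s)
  n≡ : n ≡ k + (2 + (k + s))
  n≡ = trans n≡₂ (solve 2 (λ k s → con 2 :* k :+ (con 2 :+ s) := k :+ (con 2 :+ (k :+ s))) refl k s)
  e₁ : n ∸ k ∸ 2 ≡ k + s
  e₁ = cong (_∸ 2) (trans (cong (_∸ k) n≡) (ℕ.m+n∸m≡n k (2 + (k + s))))
  e₂ : n ∸ 2 * k ∸ 1 ≡ suc s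
  e₂ = cong (_∸ 1) (trans (cong (_∸ 2 * k) n≡₂) (ℕ.m+n∸m≡n (2 * k) (2 + s)))

count-run-0 : ∀ n l k → ¬ (2 * k + 2 ≤ n) → count (range n) (run l k) ≡ 0
count-run-0 n l k ≰ = trans (ℕW.total-cong (range n) vanish) (ℕW.sumOver-0 (arrangements (range n)) (λ _ → refl))
  where
  vanish : ∀ {σ} → σ ↭ range n → run l k σ ≡ 0
  vanish {σ} p with RunsOf.run-length l k σ
  ... | inj₁ eq = eq
  ... | inj₂ le = contradiction (subst (2 * k + 2 ≤_) (trans (↭-length p) (range-length n)) le) ≰

∑-filter : {P : ℕ → Set} (P? : ∀ k → Dec (P k)) {f g : ℕ → ℕ} →
  (∀ k → P k → f k ≡ g k) → (∀ k → ¬ P k → g k ≡ 0) → ∀ ks → ∑ (filter P? ks) f ≡ ∑ ks g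
∑-filter P? eq vanish []       = refl
∑-filter P? {g = g} eq vanish (k ∷ ks) with P? k
... | yes p = cong₂ _+_ (eq k p) (∑-filter P? eq vanish ks)
... | no ¬p = trans (∑-filter P? eq vanish ks) (cong (_+ ∑ ks g) (sym (vanish k ¬p)))

recurrence : ∀ n → 2 ≤ n → ∀ l → c n l ≡ recRHS n l
recurrence n 2≤n l = begin
  c n l
    ≡⟨ c-count n l (ℕ.<⇒≤ 2≤n) ⟩
  count (range n) (clustersℤ l)
    ≡⟨ ℕW.total-cong (range n) (λ {σ} p → let len = trans (↭-length p) (range-length n) in
         clustersℤ-runs n l σ (subst (2 ≤_) (sym len) 2≤n) (ℕ.≤-reflexive len)) ⟩
  count (range n) (λ σ → ∑ (upTo n) (λ k → run (l ℤ.- ℤ.+ suc k) (suc k) σ))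
    ≡⟨ ℕW.sumOver-swap (arrangements (range n)) (upTo n) (λ σ k → run (l ℤ.- ℤ.+ suc k) (suc k) σ) ⟩
  ∑ (upTo n) (λ k → count (range n) (run (l ℤ.- ℤ.+ suc k) (suc k)))
    ≡⟨ ℕW.sumOver-map suc (upTo n) (λ k → count (range n) (run (l ℤ.- ℤ.+ k) k)) ⟨
  ∑ (range n) (λ k → count (range n) (run (l ℤ.- ℤ.+ k) k))
    ≡⟨ ∑-filter (λ k → 2 * k + 2 ≤? n) (count-run-term n l) (λ k → count-run-0 n (l ℤ.- ℤ.+ k) k) (range n) ⟨
  recRHS n l ∎

theorem1423 : ((l : ℤ) → (c 2 l ≡ 0) × (c 3 l ≡ 0))
    × ((n : ℕ) → 4 ≤ n → (l : ℤ) → c n l ≡ recRHS n l)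
    × ((R : CommutativeRing 0ℓ 0ℓ) (t : CommutativeRing.Carrier R) (n : ℕ) →
    CommutativeRing._≈_ R (EGF.prodCoeff R t n) (EGF.one R t n))
theorem1423 =
    -- For n = 2 and n = 3 no k ≥ 1 satisfies 2k + 2 ≤ n, so `recRHS` computes to 0.
    (λ l → recurrence 2 (s≤s (s≤s z≤n)) l , recurrence 3 (s≤s (s≤s z≤n)) l)
  , (λ n 4≤n → recurrence n (ℕ.≤-trans (s≤s (s≤s z≤n)) 4≤n))
  , (λ R t → GeneratingFunction.prodCoeff≈one R t)
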